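{- Let $\mathcal{S}\subseteq\mathcal{V}$ and $\mathcal{F}\subseteq\mathcal{V}^*$, with $\mathbf{D}=\mathbf{D}_{\mathcal{S}}$, $\mathbf{B}=\mathbf{B}_{\mathcal{F}}$, and $K:=\operatorname{rank}\mathbf{B}$. The orthonormal sets of $\mathcal{F}$-band-limited vectors $\{\psi_i\}_{i=1,\dots,K}$ that are maximally concentrated over $\mathcal{S}$ are given by the eigenvectors of $\mathbf{B}\mathbf{D}\mathbf{B}$: an orthonormal family $\psi_1,\dots,\psi_K$ of vectors satisfying $\mathbf{B}\psi_i=\psi_i$ is maximally concentrated over $\mathcal{S}$ if and only if $$\mathbf{B}\mathbf{D}\mathbf{B}\,\psi_i=\lambda_i\psi_i,\qquad i=1,\dots,K,$$ with $\lambda_1\ge\lambda_2\ge\dots\ge\lambda_K$. Furthermore, these vectors are orthogonal over the set $\mathcal{S}$, i.e. $$\langle\psi_i,\mathbf{D}\psi_j\rangle=\lambda_j\delta_{ij},\qquad i,j=1,\dots,K,$$ where $\delta_{ij}$ is the Kronecker symbol.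
   Context: $\mathcal{V}=\{1,\dots,N\}$ is the vertex set of a graph and $\mathcal{V}^*=\{1,\dots,N\}$ is the set of frequency indices. $\mathbf{U}\in\mathbb{C}^{N\times N}$ is a fixed arbitrary unitary matrix. For $\mathcal{S}\subseteq\mathcal{V}$, $\mathbf{D}_{\mathcal{S}}$ is the diagonal matrix whose $i$-th diagonal entry is $1$ if $i\in\mathcal{S}$ and $0$ otherwise. For $\mathcal{F}\subseteq\mathcal{V}^*$, $\mathbf{B}_{\mathcal{F}}=\mathbf{U}\mathbf{\Sigma}_{\mathcal{F}}\mathbf{U}^*$, where $\mathbf{\Sigma}_{\mathcal{F}}$ is the diagonal $0/1$ matrix with $i$-th diagonal entry $1$ if and only if $i\in\mathcal{F}$. A vector $x\in\mathbb{C}^N$ is $\mathcal{F}$-band-limited if $\mathbf{B}_{\mathcal{F}}x=x$. $\langle\cdot,\cdot\rangle$ is the standard inner product on $\mathbb{C}^N$ and $\|\cdot\|_2$ the Euclidean norm. Maximally concentrated over $\mathcal{S}$ means that $\psi_1,\dots,\psi_K$ solve the following iterative optimization problem: for each $i=1,\dots,K$, $\psi_i$ maximizes $\|\mathbf{D}\psi\|_2$ among all $\psi\in\mathbb{C}^N$ such that $\|\psi\|_2=1$, $\mathbf{B}\psi=\psi$, and (if $i>1$) $\langle\psi,\psi_j\rangle=0$ for $j=1,\dots,i-1$. -}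

module Defs where

open import Algebra.Bundles.Raw using (RawMonoid)
import Algebra.Definitions.RawMonoid as RawMonoidDefs
open import Data.Bool.Base using (if_then_else_)
open import Data.Fin.Base as Fin using (Fin)
import Data.Fin.Properties as Fin
open import Data.Fin.Subset using (Subset)
open import Data.Fin.Subset.Properties using (_∈?_)
import Data.Integer.Base as ℤ
import Data.Integer.Properties as ℤ
open import Data.Nat.Base as ℕ using (ℕ; zero; suc)
import Data.Nat.Properties as ℕ
open import Data.Product.Base using (Σ; ∃; _×_; _,_)
open import Data.Rational.Base hiding (floor)
open import Data.Rational.Properties
open import Data.Rational.Solver using (module +-*-Solver)
import Data.Rational.Unnormalised.Base as ℚᵘ
import Data.Rational.Unnormalised.Properties as ℚᵘ
open import Data.Sum.Base using (_⊎_; inj₁; inj₂; [_,_]′)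
open import Data.Vec.Functional using (Vector)
open import Level using (0ℓ)
open import Relation.Binary.PropositionalEquality
  using (_≡_; refl; sym; trans; cong; cong₂; subst; subst₂)
open import Relation.Nullary using (¬_; yes; no; contradiction)
open import Relation.Nullary.Decidable using (⌊_⌋)
open import Relation.Unary using (Decidable)

open +-*-Solver using (solve; _:=_; _:+_; _:*_; _:-_; :-_; con)

private
  half : ℚ → ℚ
  half ε = ½ * ε

  abstract
    p≤∣p∣ : ∀ p → p ≤ ∣ p ∣
    p≤∣p∣ p with ≤-total 0ℚ p
    ... | inj₁ 0≤p = ≤-reflexive (sym (0≤p⇒∣p∣≡p 0≤p))
    ... | inj₂ p≤0 = ≤-trans p≤0 (0≤∣p∣ p)

    ∣p∣<ε : ∀ {p ε} → p < ε → - p < ε → ∣ p ∣ < ε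
    ∣p∣<ε {p} {ε} p<ε -p<ε with ∣p∣≡p∨∣p∣≡-p p
    ... | inj₁ eq = subst (_< ε) (sym eq) p<ε
    ... | inj₂ eq = subst (_< ε) (sym eq) -p<ε

    *-pos : ∀ {p q} → 0ℚ < p → 0ℚ < q → 0ℚ < p * q
    *-pos {p} {q} 0<p 0<q =
      positive⁻¹ (p * q) {{pos*pos⇒pos p {{positive 0<p}} q {{positive 0<q}}}}

    *-mono-≤⁺ : ∀ {p q r s} → 0ℚ ≤ p → 0ℚ ≤ s → p ≤ q → r ≤ s → p * r ≤ q * s
    *-mono-≤⁺ {p} {q} {r} {s} 0≤p 0≤s p≤q r≤s = ≤-trans
      (*-monoˡ-≤-nonNeg p {{nonNegative 0≤p}} r≤s)
      (*-monoʳ-≤-nonNeg s {{nonNegative 0≤s}} p≤q)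

    <⇒≱ℚ : ∀ {p q} → p < q → ¬ q ≤ p
    <⇒≱ℚ p<q q≤p = <-irrefl refl (<-≤-trans p<q q≤p)

    0<½ : 0ℚ < ½
    0<½ = positive⁻¹ ½

    half-pos : ∀ {ε} → 0ℚ < ε → 0ℚ < half ε
    half-pos = *-pos 0<½

    half+half : ∀ ε → half ε + half ε ≡ ε
    half+half = solve 1 (λ ε → con ½ :* ε :+ con ½ :* ε := ε) refl

IsCauchy : (ℕ → ℚ) → Set
IsCauchy x = ∀ ε → 0ℚ < ε →
  ∃ λ N → ∀ m n → N ℕ.≤ m → N ℕ.≤ n → ∣ x m - x n ∣ < ε

-- ℝ is the setoid of Cauchy sequences of rationals: x ≈ʳ y when the difference
-- tends to 0, and x ≤ʳ y when the limit of x is at most the limit of y.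
record ℝ : Set where
  constructor mkℝ
  field
    seq    : ℕ → ℚ
    cauchy : IsCauchy seq
open ℝ public

infix 4 _≈ʳ_ _≤ʳ_

_≈ʳ_ : ℝ → ℝ → Set
x ≈ʳ y = ∀ ε → 0ℚ < ε → ∃ λ N → ∀ n → N ℕ.≤ n → ∣ seq x n - seq y n ∣ < ε

_≤ʳ_ : ℝ → ℝ → Set
x ≤ʳ y = ∀ ε → 0ℚ < ε → ∃ λ N → ∀ n → N ℕ.≤ n → seq x n ≤ seq y n + ε

fromℚ : ℚ → ℝ
fromℚ q = mkℝ (λ _ → q) λ ε 0<ε → 0 , λ _ _ _ _ →
  subst (_< ε) (cong ∣_∣ (sym (+-inverseʳ q))) 0<ε

0ʳ 1ʳ : ℝ
0ʳ = fromℚ 0ℚ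
1ʳ = fromℚ 1ℚ

private
  abstract
    +-cauchy : ∀ {x y} → IsCauchy x → IsCauchy y → IsCauchy (λ n → x n + y n)
    +-cauchy {x} {y} cx cy ε 0<ε
      with cx (half ε) (half-pos 0<ε) | cy (half ε) (half-pos 0<ε)
    ... | M , hM | N , hN = M ℕ.⊔ N , λ m n m≥ n≥ → begin-strict
      ∣ (x m + y m) - (x n + y n) ∣
        ≡⟨ cong ∣_∣ (rearr (x m) (y m) (x n) (y n)) ⟩
      ∣ (x m - x n) + (y m - y n) ∣
        ≤⟨ ∣p+q∣≤∣p∣+∣q∣ (x m - x n) (y m - y n) ⟩
      ∣ x m - x n ∣ + ∣ y m - y n ∣
        <⟨ +-mono-< (hM m n (ℕ.m⊔n≤o⇒m≤o M N m≥) (ℕ.m⊔n≤o⇒m≤o M N n≥))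
                    (hN m n (ℕ.m⊔n≤o⇒n≤o M N m≥) (ℕ.m⊔n≤o⇒n≤o M N n≥)) ⟩
      half ε + half ε
        ≡⟨ half+half ε ⟩
      ε ∎
      where
      open ≤-Reasoning
      rearr : ∀ a b c d → (a + b) - (c + d) ≡ (a - c) + (b - d)
      rearr = solve 4 (λ a b c d →
        (a :+ b) :- (c :+ d) := (a :- c) :+ (b :- d)) refl

    neg-cauchy : ∀ {x} → IsCauchy x → IsCauchy (λ n → - x n)
    neg-cauchy {x} cx ε 0<ε with cx ε 0<ε
    ... | N , h = N , λ m n m≥ n≥ →
      subst (_< ε) (trans (sym (∣-p∣≡∣p∣ (x m - x n)))
                          (cong ∣_∣ (neg-distrib-+ (x m) (- x n))))
                   (h m n m≥ n≥)

    bound : ∀ {x} → IsCauchy x →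
      ∃ λ B → 0ℚ < B × ∃ λ N → ∀ n → N ℕ.≤ n → ∣ x n ∣ ≤ B
    bound {x} cx with cx 1ℚ (positive⁻¹ 1ℚ)
    ... | N , h = 1ℚ + ∣ x N ∣ , 0<B , N , λ n n≥ → begin
      ∣ x n ∣                 ≡⟨ cong ∣_∣ (rearr (x n) (x N)) ⟩
      ∣ (x n - x N) + x N ∣   ≤⟨ ∣p+q∣≤∣p∣+∣q∣ (x n - x N) (x N) ⟩
      ∣ x n - x N ∣ + ∣ x N ∣ ≤⟨ +-monoˡ-≤ ∣ x N ∣ (<⇒≤ (h n N n≥ ℕ.≤-refl)) ⟩
      1ℚ + ∣ x N ∣            ∎
      where
      open ≤-Reasoning
      rearr : ∀ a b → a ≡ (a - b) + b
      rearr = solve 2 (λ a b → a := (a :- b) :+ b) refl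
      0<B : 0ℚ < 1ℚ + ∣ x N ∣
      0<B = +-mono-<-≤ (positive⁻¹ 1ℚ) (0≤∣p∣ (x N))

    divide : ∀ {B ε} → 0ℚ < B → 0ℚ < ε → ∃ λ δ → 0ℚ < δ × B * δ ≡ ε
    divide {B} {ε} 0<B 0<ε = ε * 1/B , *-pos 0<ε 0<1/B ,
      trans (rearr B ε 1/B) (trans (cong (ε *_) (*-inverseʳ B)) (*-identityʳ ε))
      where
      instance
        B-pos : Positive B
        B-pos = positive 0<B
        B≢0 : NonZero B
        B≢0 = pos⇒nonZero B
      1/B : ℚ
      1/B = 1/ B
      0<1/B : 0ℚ < 1/B
      0<1/B = positive⁻¹ 1/B {{1/pos⇒pos B}}
      rearr : ∀ b e c → b * (e * c) ≡ e * (b * c)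
      rearr = solve 3 (λ b e c → b :* (e :* c) := e :* (b :* c)) refl

    *-estimate : ∀ {a b c d A B α β ε} → 0ℚ < A → 0ℚ < B →
      A * α ≡ half ε → B * β ≡ half ε → ∣ a ∣ ≤ A → ∣ d ∣ ≤ B →
      ∣ a - c ∣ < β → ∣ b - d ∣ < α → ∣ a * b - c * d ∣ < ε
    *-estimate {a} {b} {c} {d} {A} {B} {α} {β} {ε} 0<A 0<B Aα Bβ a≤A d≤B a-c b-d =
      begin-strict
      ∣ a * b - c * d ∣
        ≡⟨ cong ∣_∣ (rearr a b c d) ⟩
      ∣ a * (b - d) + d * (a - c) ∣
        ≤⟨ ∣p+q∣≤∣p∣+∣q∣ (a * (b - d)) (d * (a - c)) ⟩
      ∣ a * (b - d) ∣ + ∣ d * (a - c) ∣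
        ≡⟨ cong₂ _+_ (∣p*q∣≡∣p∣*∣q∣ a (b - d)) (∣p*q∣≡∣p∣*∣q∣ d (a - c)) ⟩
      ∣ a ∣ * ∣ b - d ∣ + ∣ d ∣ * ∣ a - c ∣
        <⟨ +-mono-< (step a (b - d) 0<A a≤A b-d) (step d (a - c) 0<B d≤B a-c) ⟩
      A * α + B * β
        ≡⟨ cong₂ _+_ Aα Bβ ⟩
      half ε + half ε
        ≡⟨ half+half ε ⟩
      ε ∎
      where
      open ≤-Reasoning
      rearr : ∀ a b c d → a * b - c * d ≡ a * (b - d) + d * (a - c)
      rearr = solve 4 (λ a b c d →
        a :* b :- c :* d := a :* (b :- d) :+ d :* (a :- c)) refl
      step : ∀ p q {P δ} → 0ℚ < P → ∣ p ∣ ≤ P → ∣ q ∣ < δ → ∣ p ∣ * ∣ q ∣ < P * δ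
      step p q {P} {δ} 0<P p≤P q<δ = ≤-<-trans
        (*-monoʳ-≤-nonNeg ∣ q ∣ {{∣-∣-nonNeg q}} p≤P)
        (*-monoʳ-<-pos P {{positive 0<P}} q<δ)

    *-cauchy : ∀ {x y} → IsCauchy x → IsCauchy y → IsCauchy (λ n → x n * y n)
    *-cauchy {x} {y} cx cy ε 0<ε = go (bound cx) (bound cy)
      where
      Bound : (ℕ → ℚ) → Set
      Bound z = ∃ λ B → 0ℚ < B × ∃ λ N → ∀ n → N ℕ.≤ n → ∣ z n ∣ ≤ B
      Near : (ℕ → ℚ) → ℚ → Set
      Near z δ = ∃ λ N → ∀ m n → N ℕ.≤ m → N ℕ.≤ n → ∣ z m - z n ∣ < δ
      go′ : ∀ {A B α β M₁ N₁} → 0ℚ < A → 0ℚ < B →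
        A * α ≡ half ε → B * β ≡ half ε →
        (∀ n → M₁ ℕ.≤ n → ∣ x n ∣ ≤ A) → (∀ n → N₁ ℕ.≤ n → ∣ y n ∣ ≤ B) →
        Near x β → Near y α → Near (λ n → x n * y n) ε
      go′ {M₁ = M₁} {N₁} 0<A 0<B Aα Bβ hA hB (M₂ , hx) (N₂ , hy) =
        (M₁ ℕ.⊔ N₁) ℕ.⊔ (M₂ ℕ.⊔ N₂) , λ m n m≥ n≥ →
        let m≥₁ = ℕ.m⊔n≤o⇒m≤o (M₁ ℕ.⊔ N₁) (M₂ ℕ.⊔ N₂) m≥
            m≥₂ = ℕ.m⊔n≤o⇒n≤o (M₁ ℕ.⊔ N₁) (M₂ ℕ.⊔ N₂) m≥
            n≥₁ = ℕ.m⊔n≤o⇒m≤o (M₁ ℕ.⊔ N₁) (M₂ ℕ.⊔ N₂) n≥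
            n≥₂ = ℕ.m⊔n≤o⇒n≤o (M₁ ℕ.⊔ N₁) (M₂ ℕ.⊔ N₂) n≥
        in *-estimate {x m} {y m} {x n} {y n} 0<A 0<B Aα Bβ
             (hA m (ℕ.m⊔n≤o⇒m≤o M₁ N₁ m≥₁)) (hB n (ℕ.m⊔n≤o⇒n≤o M₁ N₁ n≥₁))
             (hx m n (ℕ.m⊔n≤o⇒m≤o M₂ N₂ m≥₂) (ℕ.m⊔n≤o⇒m≤o M₂ N₂ n≥₂))
             (hy m n (ℕ.m⊔n≤o⇒n≤o M₂ N₂ m≥₂) (ℕ.m⊔n≤o⇒n≤o M₂ N₂ n≥₂))
      go : Bound x → Bound y → Near (λ n → x n * y n) ε
      go (A , 0<A , M₁ , hA) (B , 0<B , N₁ , hB) =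
        go″ (divide 0<A (half-pos 0<ε)) (divide 0<B (half-pos 0<ε))
        where
        go″ : (∃ λ α → 0ℚ < α × A * α ≡ half ε) →
              (∃ λ β → 0ℚ < β × B * β ≡ half ε) → Near (λ n → x n * y n) ε
        go″ (α , 0<α , Aα) (β , 0<β , Bβ) =
          go′ {M₁ = M₁} {N₁} 0<A 0<B Aα Bβ hA hB (cx β 0<β) (cy α 0<α)

infixl 6 _+ʳ_
infixl 7 _*ʳ_
infix  8 -ʳ_

_+ʳ_ _*ʳ_ : ℝ → ℝ → ℝ
x +ʳ y = mkℝ (λ n → seq x n + seq y n) (+-cauchy {seq x} {seq y} (cauchy x) (cauchy y))
x *ʳ y = mkℝ (λ n → seq x n * seq y n) (*-cauchy {seq x} {seq y} (cauchy x) (cauchy y))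

-ʳ_ : ℝ → ℝ
-ʳ x = mkℝ (λ n → - seq x n) (neg-cauchy {seq x} (cauchy x))

grid : ℕ → ℕ → ℚ
grid n k = ℤ.+ k / suc n

-- The largest k ≤ b with P k; it is 0 when there is none.
greatest : {P : ℕ → Set} → Decidable P → ℕ → ℕ
greatest P? zero    = zero
greatest P? (suc b) with P? (suc b)
... | yes _ = suc b
... | no  _ = greatest P? b

Below : ℕ → ℚ → ℕ → Set
Below n q k = grid n k * grid n k ≤ q

below? : ∀ n q → Decidable (Below n q)
below? n q k = grid n k * grid n k ≤? q

-- The search bound b is chosen so that q < ((b + 1) / (n + 1))².
rootℕ : ℕ → ℚ → ℕ
rootℕ n q = greatest (below? n q) (suc ℤ.∣ ↥ q ∣ ℕ.* suc n)

-- The largest multiple of 1/(n+1) whose square is ≤ q, or 0; cf. root-lower and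
-- root-upper. Opaque only to keep conversion checking fast.
opaque
  root : ℕ → ℚ → ℚ
  root n q = grid n (rootℕ n q)

private
  gridStep : ℕ → ℚ
  gridStep n = grid n 1

  abstract
    toℚᵘ-/ : ∀ i d → toℚᵘ (i / suc d) ℚᵘ.≃ ℚᵘ.mkℚᵘ i d
    toℚᵘ-/ i d = toℚᵘ-fromℚᵘ (ℚᵘ.mkℚᵘ i d)

    ≤-/ : ∀ {i j d e} → i ℤ.* ℤ.+ suc e ℤ.≤ j ℤ.* ℤ.+ suc d → i / suc d ≤ j / suc e
    ≤-/ {i} {j} {d} {e} h = toℚᵘ-cancel-≤
      (ℚᵘ.≤-trans (ℚᵘ.≤-reflexive (toℚᵘ-/ i d))
      (ℚᵘ.≤-trans (ℚᵘ.*≤* h) (ℚᵘ.≤-reflexive (ℚᵘ.≃-sym (toℚᵘ-/ j e)))))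

    gridStep-pos : ∀ n → 0ℚ < gridStep n
    gridStep-pos n = positive⁻¹ (gridStep n) {{normalize-pos 1 (suc n)}}

    grid-suc : ∀ n k → grid n (suc k) ≡ grid n k + gridStep n
    grid-suc n k = toℚᵘ-injective (begin
      toℚᵘ (grid n (suc k))
        ≈⟨ toℚᵘ-/ (ℤ.+ suc k) n ⟩
      ℚᵘ.mkℚᵘ (ℤ.+ suc k) n
        ≈⟨ ℚᵘ.*≡* (lem k (suc n)) ⟩
      ℚᵘ.mkℚᵘ (ℤ.+ k) n ℚᵘ.+ ℚᵘ.mkℚᵘ (ℤ.+ 1) n
        ≈⟨ ℚᵘ.+-cong (toℚᵘ-/ (ℤ.+ k) n) (toℚᵘ-/ (ℤ.+ 1) n) ⟨
      toℚᵘ (grid n k) ℚᵘ.+ toℚᵘ (gridStep n)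
        ≈⟨ toℚᵘ-homo-+ (grid n k) (gridStep n) ⟨
      toℚᵘ (grid n k + gridStep n) ∎)
      where
      open import Relation.Binary.Reasoning.Setoid ℚᵘ.≃-setoid
      open import Data.Integer.Solver using () renaming (module +-*-Solver to ℤS)
      lem : ∀ k d → ℤ.+ suc k ℤ.* (ℤ.+ (d ℕ.* d))
                  ≡ (ℤ.+ k ℤ.* ℤ.+ d ℤ.+ ℤ.+ 1 ℤ.* ℤ.+ d) ℤ.* ℤ.+ d
      lem k d = trans (cong₂ ℤ._*_ (ℤ.pos-+ 1 k) (ℤ.pos-* d d))
        (ℤS.solve 2 (λ k d → (ℤS.con (ℤ.+ 1) ℤS.:+ k) ℤS.:* (d ℤS.:* d)
          ℤS.:= (k ℤS.:* d ℤS.:+ ℤS.con (ℤ.+ 1) ℤS.:* d) ℤS.:* d)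
          refl (ℤ.+ k) (ℤ.+ d))

    grid-nonNeg : ∀ n k → 0ℚ ≤ grid n k
    grid-nonNeg n zero    = ≤-/ {ℤ.+ 0} {ℤ.+ 0} {0} {n} ℤ.≤-refl
    grid-nonNeg n (suc k) = subst (0ℚ ≤_) (sym (grid-suc n k))
      (+-mono-≤ (grid-nonNeg n k) (<⇒≤ (gridStep-pos n)))

    grid-whole : ∀ n p → grid n (p ℕ.* suc n) ≡ ℤ.+ p / 1
    grid-whole n p = toℚᵘ-injective
      (ℚᵘ.≃-trans (toℚᵘ-/ (ℤ.+ (p ℕ.* suc n)) n)
      (ℚᵘ.≃-trans (ℚᵘ.*≡* (trans (ℤ.*-identityʳ _) (ℤ.pos-* p (suc n))))
                  (ℚᵘ.≃-sym (toℚᵘ-/ (ℤ.+ p) 0))))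

    q≤1+∣↥q∣ : ∀ q → q ≤ ℤ.+ suc ℤ.∣ ↥ q ∣ / 1
    q≤1+∣↥q∣ q@(mkℚ i d _) = toℚᵘ-cancel-≤
      (ℚᵘ.≤-trans (ℚᵘ.*≤* lem) (ℚᵘ.≤-reflexive (ℚᵘ.≃-sym (toℚᵘ-/ (ℤ.+ suc ℤ.∣ i ∣) 0))))
      where
      open ℤ.≤-Reasoning
      i≤∣i∣ : ∀ i → i ℤ.≤ ℤ.+ ℤ.∣ i ∣
      i≤∣i∣ (ℤ.+ n)      = ℤ.≤-refl
      i≤∣i∣ ℤ.-[1+ n ] = ℤ.-≤+
      lem : i ℤ.* ℤ.+ 1 ℤ.≤ ℤ.+ suc ℤ.∣ i ∣ ℤ.* ℤ.+ suc d
      lem = begin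
        i ℤ.* ℤ.+ 1                     ≡⟨ ℤ.*-identityʳ i ⟩
        i                               ≤⟨ i≤∣i∣ i ⟩
        ℤ.+ ℤ.∣ i ∣                     ≤⟨ ℤ.+≤+ (ℕ.n≤1+n ℤ.∣ i ∣) ⟩
        ℤ.+ suc ℤ.∣ i ∣                 ≤⟨ ℤ.+≤+ (ℕ.m≤m*n (suc ℤ.∣ i ∣) (suc d)) ⟩
        ℤ.+ (suc ℤ.∣ i ∣ ℕ.* suc d)     ≡⟨ ℤ.pos-* (suc ℤ.∣ i ∣) (suc d) ⟩
        ℤ.+ suc ℤ.∣ i ∣ ℤ.* ℤ.+ suc d   ∎

    greatest-lower : {P : ℕ → Set} (P? : Decidable P) → ∀ b →
      greatest P? b ≡ 0 ⊎ P (greatest P? b)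
    greatest-lower P? zero    = inj₁ refl
    greatest-lower P? (suc b) with P? (suc b)
    ... | yes h = inj₂ h
    ... | no  _ = greatest-lower P? b

    greatest-upper : {P : ℕ → Set} (P? : Decidable P) → ∀ b →
      ¬ P (suc b) → ¬ P (suc (greatest P? b))
    greatest-upper P? zero    h = h
    greatest-upper P? (suc b) h with P? (suc b)
    ... | yes _  = h
    ... | no  ¬p = greatest-upper P? b ¬p

opaque
  unfolding root

  root-lower : ∀ n q → root n q ≡ 0ℚ ⊎ root n q * root n q ≤ q
  root-lower n q = [ (λ k≡0 → inj₁ (trans (cong (grid n) k≡0) (grid-whole n 0))) , inj₂ ]′
    (greatest-lower (below? n q) (suc ℤ.∣ ↥ q ∣ ℕ.* suc n))

  root-upper : ∀ n q →
    q < (root n q + ℤ.+ 1 / suc n) * (root n q + ℤ.+ 1 / suc n)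
  root-upper n q = subst (λ t → q < t * t) (grid-suc n (rootℕ n q))
    (≰⇒> (greatest-upper (below? n q) b (<⇒≱ℚ (begin-strict
      q                                  ≤⟨ q≤1+∣↥q∣ q ⟩
      c                                  ≡⟨ sym (*-identityˡ c) ⟩
      1ℚ * c                             <⟨ *-monoʳ-<-pos 1ℚ c<g ⟩
      1ℚ * g                             ≤⟨ *-monoʳ-≤-nonNeg g {{nonNegative 0≤g}} 1≤g ⟩
      g * g                              ∎))))
    where
    open ≤-Reasoning
    b : ℕ
    b = suc ℤ.∣ ↥ q ∣ ℕ.* suc n
    c : ℚ
    c = ℤ.+ suc ℤ.∣ ↥ q ∣ / 1
    g : ℚ
    g = grid n (suc b)
    0≤g : 0ℚ ≤ g
    0≤g = grid-nonNeg n (suc b)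
    c<g : c < g
    c<g = subst₂ _<_ (trans (+-identityʳ (grid n b)) (grid-whole n (suc ℤ.∣ ↥ q ∣)))
      (sym (grid-suc n b)) (+-monoʳ-< (grid n b) (gridStep-pos n))
    1≤g : 1ℚ ≤ g
    1≤g = ≤-trans (≤-/ {ℤ.+ 1} {ℤ.+ suc ℤ.∣ ↥ q ∣} {0} {0}
      (ℤ.*-monoʳ-≤-nonNeg (ℤ.+ 1) (ℤ.+≤+ {1} {suc ℤ.∣ ↥ q ∣} (ℕ.s≤s ℕ.z≤n)))) (<⇒≤ c<g)

  root-nonNeg : ∀ n q → 0ℚ ≤ root n q
  root-nonNeg n q = grid-nonNeg n (rootℕ n q)

abstract
  archimedean : ∀ ε → 0ℚ < ε → ∃ λ N → ∀ n → N ℕ.≤ n → ℤ.+ 1 / suc n ≤ ε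
  archimedean (mkℚ (ℤ.+ zero) d _)      0<ε = contradiction (positive 0<ε) λ ()
  archimedean (mkℚ ℤ.-[1+ _ ] d _)     0<ε = contradiction (positive 0<ε) λ ()
  archimedean ε@(mkℚ (ℤ.+ suc k) d _) 0<ε = d , λ n d≤n → toℚᵘ-cancel-≤
    (ℚᵘ.≤-trans (ℚᵘ.≤-reflexive (toℚᵘ-/ (ℤ.+ 1) n)) (ℚᵘ.*≤* (begin
      ℤ.+ 1 ℤ.* ℤ.+ suc d       ≡⟨ ℤ.*-identityˡ _ ⟩
      ℤ.+ suc d                 ≤⟨ ℤ.+≤+ (ℕ.s≤s d≤n) ⟩
      ℤ.+ suc n                 ≤⟨ ℤ.+≤+ (ℕ.m≤n*m (suc n) (suc k)) ⟩
      ℤ.+ (suc k ℕ.* suc n)     ≡⟨ ℤ.pos-* (suc k) (suc n) ⟩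
      ℤ.+ suc k ℤ.* ℤ.+ suc n   ∎)))
    where open ℤ.≤-Reasoning

private
  abstract
    gap : ∀ {r s h ε a b} → 0ℚ < ε → 0ℚ ≤ s → 0ℚ ≤ h → h ≤ half ε → s + ε ≤ r →
      r * r ≤ a → b < (s + h) * (s + h) → half (ε * ε) < a - b
    gap {r} {s} {h} {ε} {a} {b} 0<ε 0≤s 0≤h h≤ s+ε≤r r²≤a b< =
      subst₂ _<_ (cancel b (half (ε * ε))) refl (+-monoˡ-< (- b) (begin-strict
        b + half (ε * ε)
          <⟨ +-monoˡ-< (half (ε * ε)) b< ⟩
        (s + h) * (s + h) + half (ε * ε)
          ≤⟨ +-monoˡ-≤ (half (ε * ε)) (*-mono-≤⁺ (+-mono-≤ 0≤s 0≤h) 0≤s+e s+h≤ s+h≤) ⟩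
        (s + e) * (s + e) + half (ε * ε)
          ≡⟨ sym (+-identityʳ _) ⟩
        (s + e) * (s + e) + half (ε * ε) + 0ℚ
          ≤⟨ +-monoʳ-≤ ((s + e) * (s + e) + half (ε * ε)) 0≤rest ⟩
        (s + e) * (s + e) + half (ε * ε) + (s * ε + e * e)
          ≡⟨ expand s ε ⟩
        (s + ε) * (s + ε)
          ≤⟨ *-mono-≤⁺ 0≤s+ε (≤-trans 0≤s+ε s+ε≤r) s+ε≤r s+ε≤r ⟩
        r * r
          ≤⟨ r²≤a ⟩
        a ∎))
      where
      open ≤-Reasoning
      e : ℚ
      e = half ε
      0≤e : 0ℚ ≤ e
      0≤e = <⇒≤ (half-pos 0<ε)
      0≤s+ε : 0ℚ ≤ s + ε
      0≤s+ε = +-mono-≤ 0≤s (<⇒≤ 0<ε)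
      0≤s+e : 0ℚ ≤ s + e
      0≤s+e = +-mono-≤ 0≤s 0≤e
      s+h≤ : s + h ≤ s + e
      s+h≤ = +-monoʳ-≤ s h≤
      0≤rest : 0ℚ ≤ s * ε + e * e
      0≤rest = +-mono-≤ (*-mono-≤⁺ {0ℚ} {s} {0ℚ} {ε} ≤-refl (<⇒≤ 0<ε) 0≤s (<⇒≤ 0<ε))
                        (*-mono-≤⁺ {0ℚ} {e} {0ℚ} {e} ≤-refl 0≤e 0≤e 0≤e)
      cancel : ∀ b c → (b + c) - b ≡ c
      cancel = solve 2 (λ b c → (b :+ c) :- b := c) refl
      expand : ∀ s ε → (s + ½ * ε) * (s + ½ * ε) + ½ * (ε * ε) + (s * ε + ½ * ε * (½ * ε))
                     ≡ (s + ε) * (s + ε)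
      expand = solve 2 (λ s ε →
        (s :+ con ½ :* ε) :* (s :+ con ½ :* ε) :+ con ½ :* (ε :* ε)
          :+ (s :* ε :+ con ½ :* ε :* (con ½ :* ε))
        := (s :+ ε) :* (s :+ ε)) refl

    root-cauchy : ∀ {x} → IsCauchy x → IsCauchy (λ n → root n (x n))
    root-cauchy {x} cx ε 0<ε =
      go (cx (half (ε * ε)) (half-pos (*-pos 0<ε 0<ε)))
         (archimedean (half ε) (half-pos 0<ε))
      where
      flip : ∀ a b → a - b ≡ - (b - a)
      flip = solve 2 (λ a b → a :- b := :- (b :- a)) refl
      shift : ∀ a b → b + (a - b) ≡ a
      shift = solve 2 (λ a b → b :+ (a :- b) := a) refl
      close : ∀ {a b r s h} → 0ℚ ≤ s → 0ℚ ≤ h → h ≤ half ε →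
        r ≡ 0ℚ ⊎ r * r ≤ a → b < (s + h) * (s + h) →
        ∣ a - b ∣ < half (ε * ε) → r - s < ε
      close {a} {b} {r} {s} 0≤s 0≤h h≤ lower upper a-b = ≰⇒> λ ε≤r-s →
        let s+ε≤r : s + ε ≤ r
            s+ε≤r = subst (s + ε ≤_) (shift r s) (+-monoʳ-≤ s ε≤r-s)
            0<r : 0ℚ < r
            0<r = <-≤-trans (+-mono-≤-< 0≤s 0<ε) s+ε≤r
            r²≤a = [ (λ r≡0 → contradiction 0<r (<-irrefl (sym r≡0))) , (λ h → h) ]′ lower
        in <-asym a-b (<-≤-trans
             (gap 0<ε 0≤s 0≤h h≤ s+ε≤r r²≤a upper) (p≤∣p∣ (a - b)))
      go : (∃ λ M → ∀ m n → M ℕ.≤ m → M ℕ.≤ n → ∣ x m - x n ∣ < half (ε * ε)) →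
           (∃ λ N → ∀ n → N ℕ.≤ n → ℤ.+ 1 / suc n ≤ half ε) →
           ∃ λ N → ∀ m n → N ℕ.≤ m → N ℕ.≤ n → ∣ root m (x m) - root n (x n) ∣ < ε
      go (M , hM) (N , hN) = M ℕ.⊔ N , λ m n m≥ n≥ →
        ∣p∣<ε (close′ m n m≥ n≥)
              (subst (_< ε) (flip (root n (x n)) (root m (x m))) (close′ n m n≥ m≥))
        where
        close′ : ∀ m n → M ℕ.⊔ N ℕ.≤ m → M ℕ.⊔ N ℕ.≤ n → root m (x m) - root n (x n) < ε
        close′ m n m≥ n≥ =
          close {x m} {x n} {root m (x m)} {root n (x n)} {gridStep n}
            (root-nonNeg n (x n)) (<⇒≤ (gridStep-pos n))
            (hN n (ℕ.m⊔n≤o⇒n≤o M N n≥)) (root-lower m (x m)) (root-upper n (x n))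
            (hM m n (ℕ.m⊔n≤o⇒m≤o M N m≥) (ℕ.m⊔n≤o⇒m≤o M N n≥))

-- For x < 0 the value is 0.
√_ : ℝ → ℝ
√ x = mkℝ (λ n → root n (seq x n)) (root-cauchy {seq x} (cauchy x))

infix 4 _≈_
infixl 6 _+ᶜ_
infixl 7 _*ᶜ_

record ℂ : Set where
  constructor _+i_
  field
    re im : ℝ
open ℂ public

_≈_ : ℂ → ℂ → Set
z ≈ w = re z ≈ʳ re w × im z ≈ʳ im w

_+ᶜ_ _*ᶜ_ : ℂ → ℂ → ℂ
(a +i b) +ᶜ (c +i d) = (a +ʳ c) +i (b +ʳ d)
(a +i b) *ᶜ (c +i d) = ((a *ʳ c) +ʳ (-ʳ (b *ʳ d))) +i ((a *ʳ d) +ʳ (b *ʳ c))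

fromℝ : ℝ → ℂ
fromℝ a = a +i 0ʳ

0ᶜ : ℂ
0ᶜ = fromℝ 0ʳ

conj : ℂ → ℂ
conj (a +i b) = a +i (-ʳ b)

∣_∣² : ℂ → ℝ
∣ a +i b ∣² = (a *ʳ a) +ʳ (b *ʳ b)

+ʳ-rawMonoid +ᶜ-rawMonoid : RawMonoid 0ℓ 0ℓ
+ʳ-rawMonoid = record { _≈_ = _≈ʳ_ ; _∙_ = _+ʳ_ ; ε = 0ʳ }
+ᶜ-rawMonoid = record { _≈_ = _≈_  ; _∙_ = _+ᶜ_ ; ε = 0ᶜ }

open RawMonoidDefs +ʳ-rawMonoid public using () renaming (sum to sumʳ)
open RawMonoidDefs +ᶜ-rawMonoid public using () renaming (sum to sumᶜ)

private
  variable
    N K : ℕ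

ℂ^ : ℕ → Set
ℂ^ N = Vector ℂ N

Matrix : ℕ → Set
Matrix N = Fin N → Fin N → ℂ

infix 4 _≈ᵛ_ _≈ᴹ_
infixl 7 _*ᴹ_ _·ᵛ_
infixr 7 _·_

_≈ᵛ_ : ℂ^ N → ℂ^ N → Set
x ≈ᵛ y = ∀ i → x i ≈ y i

_≈ᴹ_ : Matrix N → Matrix N → Set
A ≈ᴹ B = ∀ i j → A i j ≈ B i j

0ᵛ : ℂ^ N
0ᵛ _ = 0ᶜ

_·_ : ℂ → ℂ^ N → ℂ^ N
(c · x) i = c *ᶜ x i

_·ᵛ_ : Matrix N → ℂ^ N → ℂ^ N
(A ·ᵛ x) i = sumᶜ λ j → A i j *ᶜ x j

_*ᴹ_ : Matrix N → Matrix N → Matrix N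
(A *ᴹ B) i j = sumᶜ λ k → A i k *ᶜ B k j

_ᴴ : Matrix N → Matrix N
(A ᴴ) i j = conj (A j i)

δ : Fin N → Fin N → ℝ
δ i j = if ⌊ i Fin.≟ j ⌋ then 1ʳ else 0ʳ

I : Matrix N
I i j = fromℝ (δ i j)

Unitary : Matrix N → Set
Unitary U = (U ᴴ) *ᴹ U ≈ᴹ I × U *ᴹ (U ᴴ) ≈ᴹ I

combination : (Fin K → ℂ) → (Fin K → ℂ^ N) → ℂ^ N
combination c v i = sumᶜ λ k → c k *ᶜ v k i

LinearlyIndependent : (Fin K → ℂ^ N) → Set
LinearlyIndependent v =
  ∀ c → combination c v ≈ᵛ 0ᵛ → ∀ k → c k ≈ 0ᶜ

Range : Matrix N → ℂ^ N → Set
Range A y = ∃ λ x → A ·ᵛ x ≈ᵛ y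

-- The range of A has a basis with K elements.  A relation, not a function: equality on ℝ is not decidable.
HasRank : Matrix N → ℕ → Set
HasRank {N} A K = Σ (Fin K → ℂ^ N) λ v →
  (∀ k → Range A (v k)) ×
  LinearlyIndependent v ×
  (∀ y → Range A y → ∃ λ c → combination c v ≈ᵛ y)

-- Linear in the first argument, conjugate-linear in the second.
⟨_,_⟩ : ℂ^ N → ℂ^ N → ℂ
⟨ x , y ⟩ = sumᶜ λ i → x i *ᶜ conj (y i)

∥_∥ : ℂ^ N → ℝ
∥ x ∥ = √ (sumʳ λ i → ∣ x i ∣²)

Orthonormal : (Fin K → ℂ^ N) → Set
Orthonormal ψ = ∀ i j → ⟨ ψ i , ψ j ⟩ ≈ fromℝ (δ i j)

indicatorDiag : Subset N → Matrix N
indicatorDiag S i j = if ⌊ i ∈? S ⌋ then I i j else 0ᶜ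

D : Subset N → Matrix N
D S = indicatorDiag S

B : Matrix N → Subset N → Matrix N
B U F = U *ᴹ indicatorDiag F *ᴹ (U ᴴ)

BandLimited : Matrix N → Subset N → ℂ^ N → Set
BandLimited U F x = B U F ·ᵛ x ≈ᵛ x

module _ (U : Matrix N) (S F : Subset N) where

  Admissible : (Fin K → ℂ^ N) → Fin K → ℂ^ N → Set
  Admissible ψ i φ =
    ∥ φ ∥ ≈ʳ 1ʳ ×
    BandLimited U F φ ×
    (∀ j → j Fin.< i → ⟨ φ , ψ j ⟩ ≈ 0ᶜ)

  MaximallyConcentrated : (Fin K → ℂ^ N) → Set
  MaximallyConcentrated ψ = ∀ i →
    Admissible ψ i (ψ i) ×
    (∀ φ → Admissible ψ i φ → ∥ D S ·ᵛ φ ∥ ≤ʳ ∥ D S ·ᵛ ψ i ∥)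

  EigenvectorsOfBDB : (Fin K → ℂ^ N) → (Fin K → ℝ) → Set
  EigenvectorsOfBDB ψ λs =
    (∀ i → (B U F *ᴹ D S *ᴹ B U F) ·ᵛ ψ i ≈ᵛ fromℝ (λs i) · ψ i) ×
    (∀ i j → i Fin.≤ j → λs j ≤ʳ λs i)

{-# OPTIONS --safe #-}
-- Let Ψ have the columns ψ₁, …, ψ_K.  A basis V of the range of B gives B = V W with W V = 1,
-- so B and the projection Ψ Ψ* ≤ B both have trace K; hence ‖B - Ψ Ψ*‖² = tr B - tr Ψ Ψ* = 0
-- and every band-limited φ equals ∑ ⟨φ, ψₖ⟩ ψₖ.  If B D B ψₖ = λₖ ψₖ, it follows that
-- ‖D φ‖² = ∑ λₖ |⟨φ, ψₖ⟩|², and the maximality of ψᵢ is a termwise comparison.  Conversely, if the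
-- ψᵢ are maximally concentrated and i < k, rotating ψᵢ towards u ψₖ with |u| = 1 does not increase
-- ‖D φ‖², so the derivative 2 Re ⟨D ψᵢ, u D ψₖ⟩ is not positive; u = ±1, ±i gives
-- ⟨D ψᵢ, D ψₖ⟩ = 0, that is, the compression B D B is diagonal in the ψᵢ.
module Submission where

open import Algebra.Bundles using (CommutativeRing)
open import Algebra.Morphism.Structures using (module RingMorphisms)
import Algebra.Properties.Ring as RingProperties
import Algebra.Properties.Semiring.Sum as SemiringSum
open import Data.Bool.Base using (Bool; true; false; if_then_else_)
open import Data.Fin.Base as Fin using (zero; suc)
import Data.Fin.Properties as Fin
open import Data.Fin.Subset.Properties using (_∈?_)
open import Data.Nat.Base as ℕ using (zero; suc)
import Data.Nat.Properties as ℕ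
open import Data.Product.Base using (_,_; proj₁; proj₂)
open import Data.Sum.Base using (_⊎_; inj₁; inj₂)
open import Data.Vec.Functional using (Vector)
open import Function.Bundles using (mk⇔)
open import Level using (0ℓ; _⊔_)
open import Relation.Binary.Bundles using (Setoid; Poset)
open import Relation.Binary.Definitions using (Tri; tri<; tri≈; tri>)
import Relation.Binary.PropositionalEquality.Core as ≡
import Relation.Binary.Reasoning.PartialOrder as PosetReasoning
import Relation.Binary.Reasoning.Setoid as SetoidReasoning
open import Relation.Nullary using (¬_; does; yes; no; contradiction)
open import Relation.Nullary.Decidable using (⌊_⌋)

open import Data.Nat using (ℕ)
open import Data.Fin using (Fin)
open import Data.Fin.Subset using (Subset)
open import Data.Product using (_×_; ∃)
open import Function.Bundles using (_⇔_)

-- Traces replace them, since cyclicity turns both into the trace of the same K by K identity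
-- matrix. This part, like the spectral identities, is pure algebra and is done over any commutative
-- ring with involution; positivity enters the trace argument only where a vanishing Frobenius norm
-- becomes a vanishing matrix. The rotation would classically use cosines and a derivative. Rational
-- points of the unit circle take their place: with rational coefficients the identities between
-- reals become polynomial identities between the terms of Cauchy sequences, and a single limit, t
-- tending to 0, is left in the perturbation argument. Since norms are square roots, comparisons are
-- moved to squared norms, which are polynomial.

record IsInvolution {c ℓ} (R : CommutativeRing c ℓ)
  (conj : CommutativeRing.Carrier R → CommutativeRing.Carrier R) : Set (c ⊔ ℓ) where
  open CommutativeRing R hiding (zero)
  open RingMorphisms rawRing rawRing
  field
    isRingHomomorphism : IsRingHomomorphism conj
    involutive         : ∀ x → conj (conj x) ≈ x
  open IsRingHomomorphism isRingHomomorphism public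

-- Linear algebra over a commutative ring with involution

module StarAlgebra {c ℓ} (R : CommutativeRing c ℓ)
  (conj : CommutativeRing.Carrier R → CommutativeRing.Carrier R)
  (isInvolution : IsInvolution R conj) where

  open CommutativeRing R hiding (zero)
  open SemiringSum semiring
  open RingProperties ring using (-‿distribˡ-*; -‿distribʳ-*; -‿+-comm; -0#≈0#)
  private module * = IsInvolution isInvolution

  private
    variable
      k m n p : ℕ

  Mat : ℕ → ℕ → Set c
  Mat m n = Fin m → Fin n → Carrier

  Vec : ℕ → Set c
  Vec = Vector Carrier

  infix  4 _≋_ _≋ᵛ_
  infixl 7 _⊗_ _▹_
  infixl 6 _⊖_
  infix  9 _†

  _≋_ : Mat m n → Mat m n → Set ℓ
  A ≋ B = ∀ i j → A i j ≈ B i j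

  _≋ᵛ_ : Vec n → Vec n → Set ℓ
  x ≋ᵛ y = ∀ i → x i ≈ y i

  matSetoid : ℕ → ℕ → Setoid c ℓ
  matSetoid m n = record
    { Carrier = Mat m n
    ; _≈_ = _≋_
    ; isEquivalence = record
      { refl = λ i j → refl
      ; sym = λ h i j → sym (h i j)
      ; trans = λ h k i j → trans (h i j) (k i j)
      }
    }

  _⊗_ : Mat m n → Mat n p → Mat m p
  (A ⊗ B) i j = sum λ k → A i k * B k j

  _▹_ : Mat m n → Vec n → Vec m
  (A ▹ x) i = sum λ j → A i j * x j

  _† : Mat m n → Mat n m
  (A †) i j = conj (A j i)

  _⊖_ : Mat m n → Mat m n → Mat m n
  (A ⊖ B) i j = A i j - B i j

  -- With `does`, the entry `𝟙 (suc i) (suc j)` reduces to `𝟙 i j`; the recursions in `sum-𝟙ˡ` and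
  -- `sum-𝟙ʳ` rely on this.
  𝟙 : Mat n n
  𝟙 i j = if does (i Fin.≟ j) then 1# else 0#

  tr : Mat n n → Carrier
  tr A = sum λ i → A i i

  𝟙-diagonal : ∀ (i : Fin n) → 𝟙 i i ≈ 1#
  𝟙-diagonal i with i Fin.≟ i
  ... | yes _  = refl
  ... | no i≢i = contradiction ≡.refl i≢i

  𝟙-off-diagonal : ∀ (i j : Fin n) → ¬ i ≡.≡ j → 𝟙 i j ≈ 0#
  𝟙-off-diagonal i j i≢j with i Fin.≟ j
  ... | yes i≡j = contradiction i≡j i≢j
  ... | no _    = refl

  𝟙-sym : ∀ (i j : Fin n) → 𝟙 i j ≈ 𝟙 j i
  𝟙-sym i j with i Fin.≟ j
  ... | yes ≡.refl = sym (𝟙-diagonal i)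
  ... | no i≢j     = sym (𝟙-off-diagonal j i λ j≡i → i≢j (≡.sym j≡i))

  -- Sums

  sum-zero : ∀ {f : Vec n} → (∀ i → f i ≈ 0#) → sum f ≈ 0#
  sum-zero {n} h = trans (sum-cong-≋ h) (sum-replicate-zero n)

  sum-𝟙ˡ : ∀ (i : Fin n) (f : Vec n) → sum (λ k → 𝟙 i k * f k) ≈ f i
  sum-𝟙ˡ zero    f = trans
    (+-cong (*-identityˡ (f zero)) (sum-zero λ k → zeroˡ (f (suc k)))) (+-identityʳ (f zero))
  sum-𝟙ˡ (suc i) f = trans
    (+-cong (zeroˡ (f zero)) (sum-𝟙ˡ i λ k → f (suc k))) (+-identityˡ (f (suc i)))

  sum-𝟙ʳ : ∀ (j : Fin n) (f : Vec n) → sum (λ k → f k * 𝟙 k j) ≈ f j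
  sum-𝟙ʳ zero    f = trans
    (+-cong (*-identityʳ (f zero)) (sum-zero λ k → zeroʳ (f (suc k)))) (+-identityʳ (f zero))
  sum-𝟙ʳ (suc j) f = trans
    (+-cong (zeroʳ (f zero)) (sum-𝟙ʳ j λ k → f (suc k))) (+-identityˡ (f (suc j)))

  sum-neg : ∀ (f : Vec n) → sum (λ i → - f i) ≈ - sum f
  sum-neg {zero}  f = sym -0#≈0#
  sum-neg {suc n} f = trans (+-congˡ (sum-neg λ i → f (suc i))) (-‿+-comm (f zero) _)

  sum-minus : ∀ (f g : Vec n) → sum (λ i → f i - g i) ≈ sum f - sum g
  sum-minus f g = trans (∑-distrib-+ f (λ i → - g i)) (+-congˡ (sum-neg g))

  sum-conj : ∀ (f : Vec n) → conj (sum f) ≈ sum (λ i → conj (f i))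
  sum-conj {zero}  f = *.0#-homo
  sum-conj {suc n} f = trans (*.+-homo (f zero) _) (+-congˡ (sum-conj λ i → f (suc i)))

  -- Matrices

  ⊗-cong : ∀ {A B : Mat m n} {C D : Mat n p} → A ≋ B → C ≋ D → A ⊗ C ≋ B ⊗ D
  ⊗-cong A≋B C≋D i j = sum-cong-≋ λ k → *-cong (A≋B i k) (C≋D k j)

  ⊗-congˡ : ∀ (A : Mat m n) {C D : Mat n p} → C ≋ D → A ⊗ C ≋ A ⊗ D
  ⊗-congˡ A C≋D = ⊗-cong {A = A} (λ _ _ → refl) C≋D

  ⊗-congʳ : ∀ {A B : Mat m n} (C : Mat n p) → A ≋ B → A ⊗ C ≋ B ⊗ C
  ⊗-congʳ C A≋B = ⊗-cong {C = C} A≋B (λ _ _ → refl)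

  ⊗-assoc : ∀ (A : Mat m n) (B : Mat n p) (C : Mat p k) → (A ⊗ B) ⊗ C ≋ A ⊗ (B ⊗ C)
  ⊗-assoc A B C i j = begin
    sum (λ k → sum (λ l → A i l * B l k) * C k j)
      ≈⟨ sum-cong-≋ (λ k → *-distribʳ-sum (C k j) (λ l → A i l * B l k)) ⟩
    sum (λ k → sum (λ l → A i l * B l k * C k j))
      ≈⟨ ∑-comm (λ k l → A i l * B l k * C k j) ⟩
    sum (λ l → sum (λ k → A i l * B l k * C k j))
      ≈⟨ sum-cong-≋ (λ l → sum-cong-≋ λ k → *-assoc (A i l) (B l k) (C k j)) ⟩
    sum (λ l → sum (λ k → A i l * (B l k * C k j)))
      ≈⟨ sum-cong-≋ (λ l → *-distribˡ-sum (A i l) (λ k → B l k * C k j)) ⟨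
    sum (λ l → A i l * sum (λ k → B l k * C k j)) ∎
    where open SetoidReasoning setoid

  ⊗-identityˡ : ∀ (A : Mat m n) → 𝟙 ⊗ A ≋ A
  ⊗-identityˡ A i j = sum-𝟙ˡ i λ k → A k j

  ⊗-identityʳ : ∀ (A : Mat m n) → A ⊗ 𝟙 ≋ A
  ⊗-identityʳ A i j = sum-𝟙ʳ j (A i)

  ⊗-distribˡ-⊖ : ∀ (A : Mat m n) (B C : Mat n p) → A ⊗ (B ⊖ C) ≋ (A ⊗ B) ⊖ (A ⊗ C)
  ⊗-distribˡ-⊖ A B C i j = trans
    (sum-cong-≋ λ k → trans (distribˡ (A i k) (B k j) (- C k j))
                            (+-congˡ (sym (-‿distribʳ-* (A i k) (C k j)))))
    (sum-minus (λ k → A i k * B k j) (λ k → A i k * C k j))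

  ⊗-distribʳ-⊖ : ∀ (A : Mat n p) (B C : Mat m n) → (B ⊖ C) ⊗ A ≋ (B ⊗ A) ⊖ (C ⊗ A)
  ⊗-distribʳ-⊖ A B C i j = trans
    (sum-cong-≋ λ k → trans (distribʳ (A k j) (B i k) (- C i k))
                            (+-congˡ (sym (-‿distribˡ-* (C i k) (A k j)))))
    (sum-minus (λ k → B i k * A k j) (λ k → C i k * A k j))

  †-cong : ∀ {A B : Mat m n} → A ≋ B → A † ≋ B †
  †-cong A≋B i j = *.⟦⟧-cong (A≋B j i)

  †-involutive : ∀ (A : Mat m n) → (A †) † ≋ A
  †-involutive A i j = *.involutive (A i j)

  †-⊗ : ∀ (A : Mat m n) (B : Mat n p) → (A ⊗ B) † ≋ B † ⊗ A †
  †-⊗ A B i j = trans (sum-conj λ k → A j k * B k i)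
    (sum-cong-≋ λ k → trans (*.*-homo (A j k) (B k i)) (*-comm _ _))

  ▹-⊗ : ∀ (A : Mat m n) (B : Mat n p) (x : Vec p) → (A ⊗ B) ▹ x ≋ᵛ A ▹ (B ▹ x)
  -- The vector is treated as a matrix with one column.
  ▹-⊗ A B x i = ⊗-assoc {k = 1} A B (λ k _ → x k) i zero

  ▹-cong : ∀ {A B : Mat m n} {x y : Vec n} → A ≋ B → x ≋ᵛ y → A ▹ x ≋ᵛ B ▹ y
  ▹-cong A≋B x≋y i = sum-cong-≋ λ k → *-cong (A≋B i k) (x≋y k)

  ▹-congˡ : ∀ (A : Mat m n) {x y : Vec n} → x ≋ᵛ y → A ▹ x ≋ᵛ A ▹ y
  ▹-congˡ A = ▹-cong {A = A} (λ _ _ → refl)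

  ▹-congʳ : ∀ {A B : Mat m n} (x : Vec n) → A ≋ B → A ▹ x ≋ᵛ B ▹ x
  ▹-congʳ x A≋B = ▹-cong {x = x} A≋B (λ _ → refl)

  tr-cong : ∀ {A B : Mat n n} → A ≋ B → tr A ≈ tr B
  tr-cong A≋B = sum-cong-≋ λ i → A≋B i i

  tr-comm : ∀ (A : Mat m n) (B : Mat n m) → tr (A ⊗ B) ≈ tr (B ⊗ A)
  tr-comm A B = trans (∑-comm λ i k → A i k * B k i)
    (sum-cong-≋ λ k → sum-cong-≋ λ i → *-comm (A i k) (B k i))

  tr-⊖ : ∀ (A B : Mat n n) → tr (A ⊖ B) ≈ tr A - tr B
  tr-⊖ A B = sum-minus (λ i → A i i) (λ i → B i i)

  linearCombination : Vec k → (Fin k → Vec n) → Vec n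
  linearCombination a v i = sum λ k → a k * v k i

  columns : (Fin k → Vec n) → Mat n k
  columns v i j = v j i

  columns-⊗ : ∀ (v : Fin k → Vec n) (A : Mat k m) i j →
    (columns v ⊗ A) i j ≈ linearCombination (λ k → A k j) v i
  columns-⊗ v A i j = sum-cong-≋ λ k → *-comm (v k i) (A k j)

  -- Independence means that the matrix with columns `v` has trivial kernel; it is applied to each
  -- column of `A ⊖ B`.
  independent-cancelˡ : ∀ {v : Fin k → Vec n} →
    (∀ c → (∀ i → linearCombination c v i ≈ 0#) → ∀ k → c k ≈ 0#) →
    ∀ {A B : Mat k m} → columns v ⊗ A ≋ columns v ⊗ B → A ≋ B
  independent-cancelˡ {v = v} independent {A} {B} vA≋vB k j =
    trans (sym (+-identityʳ (A k j))) (trans (+-congˡ (sym (-‿inverseˡ (B k j))))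
      (trans (sym (+-assoc (A k j) (- B k j) (B k j)))
        (trans (+-congʳ (independent (λ k → (A ⊖ B) k j) vanish k)) (+-identityˡ (B k j)))))
    where
    vanish : ∀ i → linearCombination (λ k → (A ⊖ B) k j) v i ≈ 0#
    vanish i = begin
      linearCombination (λ k → (A ⊖ B) k j) v i         ≈⟨ columns-⊗ v (A ⊖ B) i j ⟨
      (columns v ⊗ (A ⊖ B)) i j                         ≈⟨ ⊗-distribˡ-⊖ (columns v) A B i j ⟩
      (columns v ⊗ A) i j - (columns v ⊗ B) i j         ≈⟨ +-congʳ (vA≋vB i j) ⟩
      (columns v ⊗ B) i j - (columns v ⊗ B) i j         ≈⟨ -‿inverseʳ ((columns v ⊗ B) i j) ⟩
      0#                                                ∎
      where open SetoidReasoning setoid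

  infixr 7 _∙_
  infixl 6 _⊞_

  _∙_ : Carrier → Vec n → Vec n
  (a ∙ x) i = a * x i

  _⊞_ : Vec n → Vec n → Vec n
  (x ⊞ y) i = x i + y i

  ▹-∙ : ∀ (A : Mat m n) a x → A ▹ (a ∙ x) ≋ᵛ a ∙ (A ▹ x)
  ▹-∙ A a x i = trans
    (sum-cong-≋ λ j → trans (sym (*-assoc (A i j) a (x j)))
      (trans (*-congʳ (*-comm (A i j) a)) (*-assoc a (A i j) (x j))))
    (sym (*-distribˡ-sum a λ j → A i j * x j))

  ▹-⊞ : ∀ (A : Mat m n) x y → A ▹ (x ⊞ y) ≋ᵛ A ▹ x ⊞ A ▹ y
  ▹-⊞ A x y i = trans (sum-cong-≋ λ j → distribˡ (A i j) (x j) (y j))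
    (∑-distrib-+ (λ j → A i j * x j) (λ j → A i j * y j))

  -- Orthogonal projections

  record IsProjection (P : Mat n n) : Set ℓ where
    field
      idempotent  : P ⊗ P ≋ P
      selfAdjoint : P † ≋ P

  IsProjection-resp : ∀ {P Q : Mat n n} → P ≋ Q → IsProjection P → IsProjection Q
  IsProjection-resp {n} {P} {Q} P≋Q proj = record
    { idempotent = begin
        Q ⊗ Q ≈⟨ ⊗-cong P≋Q P≋Q ⟨
        P ⊗ P ≈⟨ idempotent ⟩
        P     ≈⟨ P≋Q ⟩
        Q     ∎
    ; selfAdjoint = begin
        Q † ≈⟨ †-cong P≋Q ⟨
        P † ≈⟨ selfAdjoint ⟩
        P   ≈⟨ P≋Q ⟩
        Q   ∎
    }
    where
    open IsProjection proj
    open SetoidReasoning (matSetoid n n)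

  select : (Fin n → Bool) → Mat n n
  select s i j = if s i then 𝟙 i j else 0#

  select-isProjection : ∀ (s : Fin n → Bool) → IsProjection (select s)
  select-isProjection {n} s = record { idempotent = idem ; selfAdjoint = selfAdj }
    where
    idem : select s ⊗ select s ≋ select s
    idem i j with s i in eq
    ... | false = sum-zero λ k → zeroˡ (select s k j)
    ... | true  = trans (sum-𝟙ˡ i λ k → select s k j)
      (reflexive (≡.cong (λ b → if b then 𝟙 i j else 0#) eq))
    selfAdj : (select s) † ≋ select s
    selfAdj i j with i Fin.≟ j | j Fin.≟ i
    selfAdj i .i | yes ≡.refl | yes ≡.refl with s i
    ... | true  = *.1#-homo
    ... | false = *.0#-homo
    selfAdj i j | yes i≡j | no j≢i = contradiction (≡.sym i≡j) j≢i
    selfAdj i j | no i≢j | yes j≡i = contradiction (≡.sym j≡i) i≢j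
    selfAdj i j | no _ | no _ with s i | s j
    ... | true  | true  = *.0#-homo
    ... | true  | false = *.0#-homo
    ... | false | true  = *.0#-homo
    ... | false | false = *.0#-homo

  conjugate-isProjection : ∀ {U P : Mat n n} → U † ⊗ U ≋ 𝟙 → IsProjection P →
    IsProjection (U ⊗ P ⊗ U †)
  conjugate-isProjection {n} {U} {P} U†U≋𝟙 proj = record
    { idempotent = begin
        U ⊗ P ⊗ U † ⊗ (U ⊗ P ⊗ U †)       ≈⟨ ⊗-assoc (U ⊗ P) (U †) (U ⊗ P ⊗ U †) ⟩
        U ⊗ P ⊗ (U † ⊗ (U ⊗ P ⊗ U †))
          ≈⟨ ⊗-congˡ (U ⊗ P) (begin
               U † ⊗ (U ⊗ P ⊗ U †)        ≈⟨ ⊗-congˡ (U †) (⊗-assoc U P (U †)) ⟩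
               U † ⊗ (U ⊗ (P ⊗ U †))      ≈⟨ ⊗-assoc (U †) U (P ⊗ U †) ⟨
               U † ⊗ U ⊗ (P ⊗ U †)        ≈⟨ ⊗-congʳ (P ⊗ U †) U†U≋𝟙 ⟩
               𝟙 ⊗ (P ⊗ U †)              ≈⟨ ⊗-identityˡ (P ⊗ U †) ⟩
               P ⊗ U †                    ∎) ⟩
        U ⊗ P ⊗ (P ⊗ U †)                 ≈⟨ ⊗-assoc (U ⊗ P) P (U †) ⟨
        U ⊗ P ⊗ P ⊗ U †                   ≈⟨ ⊗-congʳ (U †) (⊗-assoc U P P) ⟩
        U ⊗ (P ⊗ P) ⊗ U †                 ≈⟨ ⊗-congʳ (U †) (⊗-congˡ U idempotent) ⟩
        U ⊗ P ⊗ U †                       ∎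
    ; selfAdjoint = begin
        (U ⊗ P ⊗ U †) †                   ≈⟨ †-⊗ (U ⊗ P) (U †) ⟩
        (U †) † ⊗ (U ⊗ P) †               ≈⟨ ⊗-cong (†-involutive U) (†-⊗ U P) ⟩
        U ⊗ (P † ⊗ U †)                   ≈⟨ ⊗-congˡ U (⊗-congʳ (U †) selfAdjoint) ⟩
        U ⊗ (P ⊗ U †)                     ≈⟨ ⊗-assoc U P (U †) ⟨
        U ⊗ P ⊗ U †                       ∎
    }
    where
    open IsProjection proj
    open SetoidReasoning (matSetoid n n)

  -- A rank-k projection P fixing k orthonormal columns Ψ equals Q = Ψ Ψ†: both have trace
  -- k, and P - Q is a projection because P Q = Q = Q P, so ‖P - Q‖² = tr P - tr Q = 0.
  module _ {P : Mat n n} (proj : IsProjection P)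
    {V : Mat n k} {W : Mat k n} (P≋VW : P ≋ V ⊗ W) (WV≋𝟙 : W ⊗ V ≋ 𝟙)
    {Ψ : Mat n k} (Ψ†Ψ≋𝟙 : Ψ † ⊗ Ψ ≋ 𝟙) (PΨ≋Ψ : P ⊗ Ψ ≋ Ψ) where
    open IsProjection proj

    private
      Q E : Mat n n
      Q = Ψ ⊗ Ψ †
      E = P ⊖ Q

      Q†≋Q : Q † ≋ Q
      Q†≋Q i j = trans (†-⊗ Ψ (Ψ †) i j) (⊗-congʳ (Ψ †) (†-involutive Ψ) i j)

      PQ≋Q : P ⊗ Q ≋ Q
      PQ≋Q i j = trans (sym (⊗-assoc P Ψ (Ψ †) i j)) (⊗-congʳ (Ψ †) PΨ≋Ψ i j)

      open SetoidReasoning (matSetoid n n)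

      QP≋Q : Q ⊗ P ≋ Q
      QP≋Q = begin
        Q ⊗ P       ≈⟨ ⊗-cong Q†≋Q selfAdjoint ⟨
        Q † ⊗ P †   ≈⟨ †-⊗ P Q ⟨
        (P ⊗ Q) †   ≈⟨ †-cong PQ≋Q ⟩
        Q †         ≈⟨ Q†≋Q ⟩
        Q           ∎

      QQ≋Q : Q ⊗ Q ≋ Q
      QQ≋Q = begin
        Q ⊗ Q               ≈⟨ ⊗-assoc Ψ (Ψ †) Q ⟩
        Ψ ⊗ (Ψ † ⊗ Q)       ≈⟨ ⊗-congˡ Ψ (λ i j → sym (⊗-assoc (Ψ †) Ψ (Ψ †) i j)) ⟩
        Ψ ⊗ (Ψ † ⊗ Ψ ⊗ Ψ †) ≈⟨ ⊗-congˡ Ψ (⊗-congʳ (Ψ †) Ψ†Ψ≋𝟙) ⟩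
        Ψ ⊗ (𝟙 ⊗ Ψ †)       ≈⟨ ⊗-congˡ Ψ (⊗-identityˡ (Ψ †)) ⟩
        Q                   ∎

      E†≋E : E † ≋ E
      E†≋E i j = trans (*.+-homo (P j i) (- Q j i))
        (+-cong (selfAdjoint i j) (trans (*.-‿homo (Q j i)) (-‿cong (Q†≋Q i j))))

      EE≋E : E ⊗ E ≋ E
      EE≋E = begin
        E ⊗ E                         ≈⟨ ⊗-distribˡ-⊖ E P Q ⟩
        (E ⊗ P) ⊖ (E ⊗ Q)
          ≈⟨ (λ i j → +-cong (⊗-distribʳ-⊖ P P Q i j) (-‿cong (⊗-distribʳ-⊖ Q P Q i j))) ⟩
        ((P ⊗ P) ⊖ (Q ⊗ P)) ⊖ ((P ⊗ Q) ⊖ (Q ⊗ Q))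
          ≈⟨ (λ i j → +-cong (+-cong (idempotent i j) (-‿cong (QP≋Q i j)))
               (trans (-‿cong (trans (+-cong (PQ≋Q i j) (-‿cong (QQ≋Q i j))) (-‿inverseʳ (Q i j))))
                      -0#≈0#)) ⟩
        (λ i j → E i j + 0#)          ≈⟨ (λ i j → +-identityʳ (E i j)) ⟩
        E                             ∎

    -- Over a general ring with involution a vanishing Frobenius norm does not force the matrix to
    -- vanish, so the algebraic argument stops here; `frobenius-definite` completes it over `ℂ`.
    resolution-defect : tr ((P ⊖ Ψ ⊗ Ψ †) † ⊗ (P ⊖ Ψ ⊗ Ψ †)) ≈ 0#
    resolution-defect = trans (tr-cong λ i j → trans (⊗-congʳ E E†≋E i j) (EE≋E i j))
      (trans (tr-⊖ P Q) (trans (+-congʳ trP≈trQ) (-‿inverseʳ (tr Q))))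
      where
      trP≈trQ : tr P ≈ tr Q
      trP≈trQ = trans (tr-cong P≋VW) (trans (tr-comm V W) (trans
        (tr-cong λ i j → trans (WV≋𝟙 i j) (sym (Ψ†Ψ≋𝟙 i j))) (tr-comm (Ψ †) Ψ)))

  -- Inner products

  ⟪_,_⟫ : Vec n → Vec n → Carrier
  ⟪ x , y ⟫ = sum λ i → x i * conj (y i)

  inner-cong : ∀ {x x′ y y′ : Vec n} → x ≋ᵛ x′ → y ≋ᵛ y′ → ⟪ x , y ⟫ ≈ ⟪ x′ , y′ ⟫
  inner-cong x≋x′ y≋y′ = sum-cong-≋ λ i → *-cong (x≋x′ i) (*.⟦⟧-cong (y≋y′ i))

  inner-congˡ : ∀ (x : Vec n) {y y′} → y ≋ᵛ y′ → ⟪ x , y ⟫ ≈ ⟪ x , y′ ⟫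
  inner-congˡ x = inner-cong {x = x} (λ _ → refl)

  inner-congʳ : ∀ {x x′} (y : Vec n) → x ≋ᵛ x′ → ⟪ x , y ⟫ ≈ ⟪ x′ , y ⟫
  inner-congʳ y x≋x′ = inner-cong {y = y} x≋x′ (λ _ → refl)

  inner-conj : ∀ (x y : Vec n) → conj ⟪ x , y ⟫ ≈ ⟪ y , x ⟫
  inner-conj x y = trans (sum-conj λ i → x i * conj (y i)) (sum-cong-≋ λ i →
    trans (*.*-homo (x i) (conj (y i))) (trans (*-congˡ (*.involutive (y i))) (*-comm _ _)))

  inner-⊞ˡ : ∀ (x y z : Vec n) → ⟪ x ⊞ y , z ⟫ ≈ ⟪ x , z ⟫ + ⟪ y , z ⟫
  inner-⊞ˡ x y z = trans (sum-cong-≋ λ i → distribʳ (conj (z i)) (x i) (y i))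
    (∑-distrib-+ (λ i → x i * conj (z i)) (λ i → y i * conj (z i)))

  inner-∙ˡ : ∀ a (x y : Vec n) → ⟪ a ∙ x , y ⟫ ≈ a * ⟪ x , y ⟫
  inner-∙ˡ a x y = trans (sum-cong-≋ λ i → *-assoc a (x i) (conj (y i)))
    (sym (*-distribˡ-sum a λ i → x i * conj (y i)))

  inner-∙ʳ : ∀ a (x y : Vec n) → ⟪ x , a ∙ y ⟫ ≈ conj a * ⟪ x , y ⟫
  inner-∙ʳ a x y = begin
    ⟪ x , a ∙ y ⟫             ≈⟨ inner-conj (a ∙ y) x ⟨
    conj ⟪ a ∙ y , x ⟫        ≈⟨ *.⟦⟧-cong (inner-∙ˡ a y x) ⟩
    conj (a * ⟪ y , x ⟫)      ≈⟨ *.*-homo a ⟪ y , x ⟫ ⟩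
    conj a * conj ⟪ y , x ⟫   ≈⟨ *-congˡ (inner-conj y x) ⟩
    conj a * ⟪ x , y ⟫        ∎
    where open SetoidReasoning setoid

  inner-linearCombinationˡ : ∀ (a : Vec k) (v : Fin k → Vec n) y →
    ⟪ linearCombination a v , y ⟫ ≈ sum λ k → a k * ⟪ v k , y ⟫
  inner-linearCombinationˡ a v y = begin
    sum (λ i → sum (λ k → a k * v k i) * conj (y i))
      ≈⟨ sum-cong-≋ (λ i → *-distribʳ-sum (conj (y i)) (λ k → a k * v k i)) ⟩
    sum (λ i → sum (λ k → a k * v k i * conj (y i)))
      ≈⟨ ∑-comm (λ i k → a k * v k i * conj (y i)) ⟩
    sum (λ k → ⟪ a k ∙ v k , y ⟫)
      ≈⟨ sum-cong-≋ (λ k → inner-∙ˡ (a k) (v k) y) ⟩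
    sum (λ k → a k * ⟪ v k , y ⟫) ∎
    where open SetoidReasoning setoid

  inner-linearCombinationʳ : ∀ x (a : Vec k) (v : Fin k → Vec n) →
    ⟪ x , linearCombination a v ⟫ ≈ sum λ k → ⟪ x , v k ⟫ * conj (a k)
  inner-linearCombinationʳ x a v = begin
    ⟪ x , linearCombination a v ⟫               ≈⟨ inner-conj (linearCombination a v) x ⟨
    conj ⟪ linearCombination a v , x ⟫          ≈⟨ *.⟦⟧-cong (inner-linearCombinationˡ a v x) ⟩
    conj (sum λ k → a k * ⟪ v k , x ⟫)          ≈⟨ sum-conj (λ k → a k * ⟪ v k , x ⟫) ⟩
    sum (λ k → conj (a k * ⟪ v k , x ⟫))
      ≈⟨ sum-cong-≋ (λ k → trans (*.*-homo (a k) ⟪ v k , x ⟫)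
           (trans (*-congˡ (inner-conj (v k) x)) (*-comm _ _))) ⟩
    sum (λ k → ⟪ x , v k ⟫ * conj (a k))        ∎
    where open SetoidReasoning setoid

  inner-adjoint : ∀ (A : Mat m n) x y → ⟪ A ▹ x , y ⟫ ≈ ⟪ x , A † ▹ y ⟫
  inner-adjoint A x y = begin
    sum (λ i → sum (λ j → A i j * x j) * conj (y i))
      ≈⟨ sum-cong-≋ (λ i → *-distribʳ-sum (conj (y i)) (λ j → A i j * x j)) ⟩
    sum (λ i → sum (λ j → A i j * x j * conj (y i)))
      ≈⟨ ∑-comm (λ i j → A i j * x j * conj (y i)) ⟩
    sum (λ j → sum (λ i → A i j * x j * conj (y i)))
      ≈⟨ sum-cong-≋ (λ j → sum-cong-≋ λ i → begin
           A i j * x j * conj (y i)                 ≈⟨ *-congʳ (*-comm (A i j) (x j)) ⟩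
           x j * A i j * conj (y i)                 ≈⟨ *-assoc (x j) (A i j) (conj (y i)) ⟩
           x j * (A i j * conj (y i))               ≈⟨ *-congˡ (*-congʳ (*.involutive (A i j))) ⟨
           x j * (conj (conj (A i j)) * conj (y i)) ≈⟨ *-congˡ (*.*-homo (conj (A i j)) (y i)) ⟨
           x j * conj (conj (A i j) * y i)          ∎) ⟩
    sum (λ j → sum (λ i → x j * conj (conj (A i j) * y i)))
      ≈⟨ sum-cong-≋ (λ j → *-distribˡ-sum (x j) (λ i → conj (conj (A i j) * y i))) ⟨
    sum (λ j → x j * sum (λ i → conj (conj (A i j) * y i)))
      ≈⟨ sum-cong-≋ (λ j → *-congˡ (sum-conj λ i → conj (A i j) * y i)) ⟨
    ⟪ x , A † ▹ y ⟫ ∎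
    where open SetoidReasoning setoid

  module _ {P : Mat n n} (proj : IsProjection P) where
    open IsProjection proj

    inner-selfAdjoint : ∀ x y → ⟪ P ▹ x , y ⟫ ≈ ⟪ x , P ▹ y ⟫
    inner-selfAdjoint x y = trans (inner-adjoint P x y) (inner-congˡ x (▹-congʳ y selfAdjoint))

    ▹-idempotent : ∀ x → P ▹ (P ▹ x) ≋ᵛ P ▹ x
    ▹-idempotent x i = trans (sym (▹-⊗ P P x i)) (▹-congʳ x idempotent i)

    inner-projected : ∀ x y → ⟪ P ▹ x , P ▹ y ⟫ ≈ ⟪ P ▹ x , y ⟫
    inner-projected x y = begin
      ⟪ P ▹ x , P ▹ y ⟫   ≈⟨ inner-selfAdjoint (P ▹ x) y ⟨
      ⟪ P ▹ (P ▹ x) , y ⟫ ≈⟨ inner-congʳ y (▹-idempotent x) ⟩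
      ⟪ P ▹ x , y ⟫       ∎
      where open SetoidReasoning setoid

  -- Compressions of projections

  module Compression {P D : Mat n n} (projP : IsProjection P) (projD : IsProjection D)
    {ψ : Fin k → Vec n} (orthonormal : ∀ i j → ⟪ ψ i , ψ j ⟫ ≈ 𝟙 i j)
    (resolution : P ≋ columns ψ ⊗ columns ψ †) (fixed : ∀ i → P ▹ ψ i ≋ᵛ ψ i) where

    open SetoidReasoning setoid

    expansion : ∀ {x} → P ▹ x ≋ᵛ x → x ≋ᵛ linearCombination (λ k → ⟪ x , ψ k ⟫) ψ
    expansion {x} Px≋x i = begin
      x i                                   ≈⟨ Px≋x i ⟨
      (P ▹ x) i                             ≈⟨ ▹-congʳ x resolution i ⟩
      (columns ψ ⊗ columns ψ † ▹ x) i       ≈⟨ ▹-⊗ (columns ψ) (columns ψ †) x i ⟩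
      (columns ψ ▹ (columns ψ † ▹ x)) i
        ≈⟨ sum-cong-≋ (λ k → trans (*-comm _ _)
             (*-congʳ (sum-cong-≋ λ l → *-comm (conj (ψ k l)) (x l)))) ⟩
      linearCombination (λ k → ⟪ x , ψ k ⟫) ψ i ∎

    -- Only the second vector is expanded: in `eigenvalue-concentration` the first one is `D ▹ x`,
    -- which in general leaves the range of `P`.
    parseval : ∀ x {y} → P ▹ y ≋ᵛ y → ⟪ x , y ⟫ ≈ sum λ k → ⟪ x , ψ k ⟫ * conj ⟪ y , ψ k ⟫
    parseval x {y} Py≋y = trans (inner-congˡ x (expansion Py≋y))
      (inner-linearCombinationʳ x (λ k → ⟪ y , ψ k ⟫) ψ)

    compress : ∀ x → P ▹ x ≋ᵛ x → P ⊗ D ⊗ P ▹ x ≋ᵛ P ▹ (D ▹ x)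
    compress x Px≋x i = begin
      (P ⊗ D ⊗ P ▹ x) i     ≈⟨ ▹-⊗ (P ⊗ D) P x i ⟩
      (P ⊗ D ▹ (P ▹ x)) i   ≈⟨ ▹-congˡ (P ⊗ D) Px≋x i ⟩
      (P ⊗ D ▹ x) i         ≈⟨ ▹-⊗ P D x i ⟩
      (P ▹ (D ▹ x)) i       ∎

    module _ {μ : Vec k} (real : ∀ i → conj (μ i) ≈ μ i)
      (eigen : ∀ i → P ⊗ D ⊗ P ▹ ψ i ≋ᵛ μ i ∙ ψ i) where

      -- As `x` is fixed by the self-adjoint `P`, its pairing with `D ▹ ψ j` sees only the
      -- compression of `D` applied to `ψ j`. The eigenvalue leaves the second slot conjugated,
      -- which is where `real` enters.
      eigenvalue-inner : ∀ j {x} → P ▹ x ≋ᵛ x → ⟪ x , D ▹ ψ j ⟫ ≈ μ j * ⟪ x , ψ j ⟫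
      eigenvalue-inner j {x} Px≋x = begin
        ⟪ x , D ▹ ψ j ⟫             ≈⟨ inner-congʳ (D ▹ ψ j) Px≋x ⟨
        ⟪ P ▹ x , D ▹ ψ j ⟫         ≈⟨ inner-selfAdjoint projP x (D ▹ ψ j) ⟩
        ⟪ x , P ▹ (D ▹ ψ j) ⟫       ≈⟨ inner-congˡ x (compress (ψ j) (fixed j)) ⟨
        ⟪ x , P ⊗ D ⊗ P ▹ ψ j ⟫     ≈⟨ inner-congˡ x (eigen j) ⟩
        ⟪ x , μ j ∙ ψ j ⟫           ≈⟨ inner-∙ʳ (μ j) x (ψ j) ⟩
        conj (μ j) * ⟪ x , ψ j ⟫    ≈⟨ *-congʳ (real j) ⟩
        μ j * ⟪ x , ψ j ⟫           ∎

      eigenvectors-orthogonal : ∀ i j → ⟪ ψ i , D ▹ ψ j ⟫ ≈ μ j * 𝟙 i j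
      eigenvectors-orthogonal i j = trans (eigenvalue-inner j (fixed i)) (*-congˡ (orthonormal i j))

      eigenvalue-concentration : ∀ {x} → P ▹ x ≋ᵛ x →
        ⟪ D ▹ x , D ▹ x ⟫ ≈ sum λ k → μ k * (⟪ x , ψ k ⟫ * conj ⟪ x , ψ k ⟫)
      eigenvalue-concentration {x} Px≋x = begin
        ⟪ D ▹ x , D ▹ x ⟫ ≈⟨ inner-projected projD x x ⟩
        ⟪ D ▹ x , x ⟫     ≈⟨ parseval (D ▹ x) Px≋x ⟩
        sum (λ k → ⟪ D ▹ x , ψ k ⟫ * conj ⟪ x , ψ k ⟫)
          ≈⟨ sum-cong-≋ (λ k → trans
               (*-congʳ (trans (inner-selfAdjoint projD x (ψ k)) (eigenvalue-inner k Px≋x)))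
               (*-assoc (μ k) ⟪ x , ψ k ⟫ (conj ⟪ x , ψ k ⟫))) ⟩
        sum (λ k → μ k * (⟪ x , ψ k ⟫ * conj ⟪ x , ψ k ⟫)) ∎

    -- The compressed vector lies in the range of `P`, so it is determined by its coefficients
    -- against `ψ`, and these are the entries of the Gram matrix of the vectors `D ▹ ψ k`.
    diagonal⇒eigen : ∀ {μ : Vec k} → (∀ i j → ⟪ D ▹ ψ i , D ▹ ψ j ⟫ ≈ μ i * 𝟙 i j) →
      ∀ i → P ⊗ D ⊗ P ▹ ψ i ≋ᵛ μ i ∙ ψ i
    diagonal⇒eigen {μ} diagonal i l = begin
      (P ⊗ D ⊗ P ▹ ψ i) l     ≈⟨ compress (ψ i) (fixed i) l ⟩
      y l                     ≈⟨ expansion (▹-idempotent projP (D ▹ ψ i)) l ⟩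
      sum (λ k → ⟪ y , ψ k ⟫ * ψ k l)
        ≈⟨ sum-cong-≋ (λ k → trans (*-congʳ (coefficient k)) (*-assoc (μ i) (𝟙 i k) (ψ k l))) ⟩
      sum (λ k → μ i * (𝟙 i k * ψ k l))  ≈⟨ *-distribˡ-sum (μ i) (λ k → 𝟙 i k * ψ k l) ⟨
      μ i * sum (λ k → 𝟙 i k * ψ k l)    ≈⟨ *-congˡ (sum-𝟙ˡ i λ k → ψ k l) ⟩
      μ i * ψ i l                        ∎
      where
      y : Vec n
      y = P ▹ (D ▹ ψ i)
      coefficient : ∀ k → ⟪ y , ψ k ⟫ ≈ μ i * 𝟙 i k
      coefficient k = begin
        ⟪ y , ψ k ⟫               ≈⟨ inner-selfAdjoint projP (D ▹ ψ i) (ψ k) ⟩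
        ⟪ D ▹ ψ i , P ▹ ψ k ⟫     ≈⟨ inner-congˡ (D ▹ ψ i) (fixed k) ⟩
        ⟪ D ▹ ψ i , ψ k ⟫         ≈⟨ inner-projected projD (ψ i) (ψ k) ⟨
        ⟪ D ▹ ψ i , D ▹ ψ k ⟫     ≈⟨ diagonal i k ⟩
        μ i * 𝟙 i k               ∎

open import Defs
import Data.Integer.Base as ℤ
open import Data.Rational.Base using
  (ℚ; 0ℚ; 1ℚ; ½; _+_; _*_; -_; _-_; ∣_∣; _≤_; _<_; _/_; 1/_; Positive; NonZero;
   positive; nonNegative)
open import Data.Rational.Properties hiding (≃-sym)
open import Data.Rational.Solver using (module +-*-Solver)
open import Relation.Binary.PropositionalEquality
  using (_≡_; refl; sym; trans; cong; cong₂; subst; subst₂)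

open +-*-Solver using (solve; _:=_; _:+_; _:*_; _:-_; :-_; con)

-- Rational estimates

*-pos : ∀ {p q} → 0ℚ < p → 0ℚ < q → 0ℚ < p * q
*-pos {p} {q} 0<p 0<q =
  positive⁻¹ (p * q) {{pos*pos⇒pos p {{positive 0<p}} q {{positive 0<q}}}}

*-nonNeg : ∀ {p q} → 0ℚ ≤ p → 0ℚ ≤ q → 0ℚ ≤ p * q
*-nonNeg {p} {q} 0≤p 0≤q = nonNegative⁻¹ (p * q)
  {{nonNeg*nonNeg⇒nonNeg p {{nonNegative 0≤p}} q {{nonNegative 0≤q}}}}

square-nonNeg : ∀ p → 0ℚ ≤ p * p
square-nonNeg p with ∣p∣≡p∨∣p∣≡-p p
... | inj₁ eq = *-nonNeg 0≤p 0≤p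
  where 0≤p = ∣p∣≡p⇒0≤p eq
... | inj₂ eq = subst (0ℚ ≤_) (neg-square p) (*-nonNeg 0≤-p 0≤-p)
  where
  0≤-p : 0ℚ ≤ - p
  0≤-p = subst (0ℚ ≤_) eq (0≤∣p∣ p)
  neg-square : ∀ p → - p * - p ≡ p * p
  neg-square = solve 1 (λ p → :- p :* :- p := p :* p) refl

p≤∣p∣ : ∀ p → p ≤ ∣ p ∣
p≤∣p∣ p with ≤-total 0ℚ p
... | inj₁ 0≤p = ≤-reflexive (sym (0≤p⇒∣p∣≡p 0≤p))
... | inj₂ p≤0 = ≤-trans p≤0 (0≤∣p∣ p)

p-q≤ε⇒p≤q+ε : ∀ {p q ε} → p - q ≤ ε → p ≤ q + ε
p-q≤ε⇒p≤q+ε {p} {q} {ε} h = subst (_≤ q + ε) (eq p q) (+-monoʳ-≤ q h)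
  where
  eq : ∀ p q → q + (p - q) ≡ p
  eq = solve 2 (λ p q → q :+ (p :- q) := p) refl

p≤q+ε⇒p-q≤ε : ∀ {p q ε} → p ≤ q + ε → p - q ≤ ε
p≤q+ε⇒p-q≤ε {p} {q} {ε} h = subst (p - q ≤_) (eq q ε) (+-monoˡ-≤ (- q) h)
  where
  eq : ∀ q ε → q + ε - q ≡ ε
  eq = solve 2 (λ q ε → q :+ ε :- q := ε) refl

∣p-q∣≤ε : ∀ {p q ε} → p ≤ q + ε → q ≤ p + ε → ∣ p - q ∣ ≤ ε
∣p-q∣≤ε {p} {q} {ε} p≤ q≤ with ∣p∣≡p∨∣p∣≡-p (p - q)
... | inj₁ eq = subst (_≤ ε) (sym eq) (p≤q+ε⇒p-q≤ε p≤)
... | inj₂ eq = subst (_≤ ε) (sym (trans eq (flip p q))) (p≤q+ε⇒p-q≤ε q≤)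
  where
  flip : ∀ p q → - (p - q) ≡ q - p
  flip = solve 2 (λ p q → :- (p :- q) := q :- p) refl

∣p-q∣≤ε⇒p≤q+ε : ∀ {p q ε} → ∣ p - q ∣ ≤ ε → p ≤ q + ε
∣p-q∣≤ε⇒p≤q+ε {p} {q} h = p-q≤ε⇒p≤q+ε (≤-trans (p≤∣p∣ (p - q)) h)

*-mono-≤-nonNeg : ∀ {p q r s} → 0ℚ ≤ p → 0ℚ ≤ s → p ≤ q → r ≤ s → p * r ≤ q * s
*-mono-≤-nonNeg {p} {s = s} 0≤p 0≤s p≤q r≤s = ≤-trans
  (*-monoˡ-≤-nonNeg p {{nonNegative 0≤p}} r≤s)
  (*-monoʳ-≤-nonNeg s {{nonNegative 0≤s}} p≤q)

square-cancel-≤ : ∀ {p q} → 0ℚ ≤ q → p * p ≤ q * q → p ≤ q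
square-cancel-≤ {p} {q} 0≤q p²≤q² with p ≤? q
... | yes p≤q = p≤q
... | no  p≰q = contradiction (<-≤-trans (≤-<-trans
  (*-mono-≤-nonNeg 0≤q (<⇒≤ 0<p) ≤-refl (<⇒≤ q<p))
  (*-monoˡ-<-pos p {{positive 0<p}} q<p)) p²≤q²) (<-irrefl refl)
  where
  q<p = ≰⇒> p≰q
  0<p = ≤-<-trans 0≤q q<p

divide : ∀ {p q} → 0ℚ < p → 0ℚ < q → ∃ λ r → 0ℚ < r × p * r ≡ q
divide {p} {q} 0<p 0<q = q * (1/ p) , *-pos 0<q (positive⁻¹ (1/ p) {{1/pos⇒pos p}}) ,
  trans (eq p q (1/ p)) (trans (cong (q *_) (*-inverseʳ p)) (*-identityʳ q))
  where
  instance
    p-pos : Positive p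
    p-pos = positive 0<p
    p≢0 : NonZero p
    p≢0 = pos⇒nonZero p
  eq : ∀ p q r → p * (q * r) ≡ q * (p * r)
  eq = solve 3 (λ p q r → p :* (q :* r) := q :* (p :* r)) refl

0<½ε : ∀ {ε} → 0ℚ < ε → 0ℚ < ½ * ε
0<½ε = *-pos (positive⁻¹ ½)

½ε+½ε≡ε : ∀ ε → ½ * ε + ½ * ε ≡ ε
½ε+½ε≡ε = solve 1 (λ ε → con ½ :* ε :+ con ½ :* ε := ε) refl

½ε<ε : ∀ {ε} → 0ℚ < ε → ½ * ε < ε
½ε<ε {ε} 0<ε = subst₂ _<_ (+-identityʳ (½ * ε)) (½ε+½ε≡ε ε) (+-monoʳ-< (½ * ε) (0<½ε 0<ε))

-- Real numbers as an ordered commutative ring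

Eventually : (ℕ → Set) → Set
Eventually P = ∃ λ N → ∀ n → N ℕ.≤ n → P n

ev-map : ∀ {P Q : ℕ → Set} → (∀ n → P n → Q n) → Eventually P → Eventually Q
ev-map f (N , p) = N , λ n N≤n → f n (p n N≤n)

ev-map₂ : ∀ {P Q R : ℕ → Set} → (∀ n → P n → Q n → R n) →
  Eventually P → Eventually Q → Eventually R
ev-map₂ f (M , p) (N , q) = M ℕ.⊔ N , λ n n≥ →
  f n (p n (ℕ.m⊔n≤o⇒m≤o M N n≥)) (q n (ℕ.m⊔n≤o⇒n≤o M N n≥))

EventuallyBoundedBy : ℝ → ℚ → Set
EventuallyBoundedBy x b = 0ℚ < b × Eventually λ n → ∣ seq x n ∣ ≤ b

eventually-bounded : ∀ x → ∃ (EventuallyBoundedBy x)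
eventually-bounded x with cauchy x 1ℚ (positive⁻¹ 1ℚ)
... | N , h = 1ℚ + ∣ seq x N ∣ , +-mono-<-≤ (positive⁻¹ 1ℚ) (0≤∣p∣ (seq x N)) , N , λ n N≤n → begin
  ∣ seq x n ∣                         ≡⟨ cong ∣_∣ (eq (seq x n) (seq x N)) ⟩
  ∣ (seq x n - seq x N) + seq x N ∣   ≤⟨ ∣p+q∣≤∣p∣+∣q∣ (seq x n - seq x N) (seq x N) ⟩
  ∣ seq x n - seq x N ∣ + ∣ seq x N ∣ ≤⟨ +-monoˡ-≤ ∣ seq x N ∣ (<⇒≤ (h n N N≤n ℕ.≤-refl)) ⟩
  1ℚ + ∣ seq x N ∣                    ∎
  where
  open ≤-Reasoning
  eq : ∀ p q → p ≡ (p - q) + q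
  eq = solve 2 (λ p q → p := (p :- q) :+ q) refl

-- Wrapped in records because Agda cannot recover x and y from the unfolded relations.
infix 4 _≃_ _≼_

record _≃_ (x y : ℝ) : Set where
  constructor mk≃
  field un≃ : x ≈ʳ y
open _≃_ public

record _≼_ (x y : ℝ) : Set where
  constructor mk≼
  field un≼ : x ≤ʳ y
open _≼_ public

-- Stronger than `0ʳ ≼ x`, since every term and not just the limit is nonnegative. Squared moduli,
-- their sums and square roots satisfy it as they are represented, and it allows estimates on
-- rational terms without extra slack.
PointwiseNonNeg : ℝ → Set
PointwiseNonNeg x = ∀ n → 0ℚ ≤ seq x n

-- The operations of `ℝ` act termwise, so this transfers ring identities from `ℚ`, where the solver
-- proves them.
pointwise : ∀ {x y} → (∀ n → seq x n ≡ seq y n) → x ≃ y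
pointwise {x} {y} eq = mk≃ λ ε 0<ε → 0 , λ n _ →
  subst (_< ε) (cong ∣_∣ (sym (trans (cong (_- seq y n) (eq n)) (+-inverseʳ (seq y n))))) 0<ε

pointwise-≼ : ∀ {x y} → (∀ n → seq x n ≤ seq y n) → x ≼ y
pointwise-≼ {x} {y} le = mk≼ λ ε 0<ε → 0 , λ n _ →
  subst (_≤ seq y n + ε) (+-identityʳ (seq x n)) (+-mono-≤ (le n) (<⇒≤ 0<ε))

≃-refl : ∀ {x} → x ≃ x
≃-refl = pointwise (λ _ → refl)

≃-sym : ∀ {x y} → x ≃ y → y ≃ x
≃-sym {x} {y} (mk≃ x≈y) = mk≃ λ ε 0<ε → ev-map
  (λ n → subst (_< ε) (trans (sym (∣-p∣≡∣p∣ (seq x n - seq y n)))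
                             (cong ∣_∣ (flip (seq x n) (seq y n)))))
  (x≈y ε 0<ε)
  where
  flip : ∀ p q → - (p - q) ≡ q - p
  flip = solve 2 (λ p q → :- (p :- q) := q :- p) refl

≼-reflexive : ∀ {x y} → x ≃ y → x ≼ y
≼-reflexive (mk≃ x≈y) = mk≼ λ ε 0<ε → ev-map (λ n h → ∣p-q∣≤ε⇒p≤q+ε (<⇒≤ h)) (x≈y ε 0<ε)

≼-antisym : ∀ {x y} → x ≼ y → y ≼ x → x ≃ y
≼-antisym (mk≼ x≤y) (mk≼ y≤x) = mk≃ λ ε 0<ε →
  -- The order yields only a weak inequality; halving ε recovers the strict one demanded by `_≈ʳ_`.
  ev-map₂ (λ n h k → ≤-<-trans (∣p-q∣≤ε h k) (½ε<ε 0<ε))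
    (x≤y (½ * ε) (0<½ε 0<ε)) (y≤x (½ * ε) (0<½ε 0<ε))

≼-trans : ∀ {x y z} → x ≼ y → y ≼ z → x ≼ z
≼-trans {x} {y} {z} (mk≼ x≤y) (mk≼ y≤z) = mk≼ λ ε 0<ε → ev-map₂
  (λ n h k → begin
    seq x n                     ≤⟨ h ⟩
    seq y n + ½ * ε             ≤⟨ +-monoˡ-≤ (½ * ε) k ⟩
    seq z n + ½ * ε + ½ * ε     ≡⟨ +-assoc (seq z n) (½ * ε) (½ * ε) ⟩
    seq z n + (½ * ε + ½ * ε)   ≡⟨ cong (seq z n +_) (½ε+½ε≡ε ε) ⟩
    seq z n + ε                 ∎)
  (x≤y (½ * ε) (0<½ε 0<ε)) (y≤z (½ * ε) (0<½ε 0<ε))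
  where open ≤-Reasoning

≃-trans : ∀ {x y z} → x ≃ y → y ≃ z → x ≃ z
≃-trans x≃y y≃z = ≼-antisym
  (≼-trans (≼-reflexive x≃y) (≼-reflexive y≃z))
  (≼-trans (≼-reflexive (≃-sym y≃z)) (≼-reflexive (≃-sym x≃y)))

+-mono-≼ : ∀ {x y u v} → x ≼ y → u ≼ v → x +ʳ u ≼ y +ʳ v
+-mono-≼ {x} {y} {u} {v} (mk≼ x≤y) (mk≼ u≤v) = mk≼ λ ε 0<ε → ev-map₂
  (λ n h k → begin
    seq x n + seq u n                           ≤⟨ +-mono-≤ h k ⟩
    (seq y n + ½ * ε) + (seq v n + ½ * ε)       ≡⟨ eq (seq y n) (seq v n) ε ⟩
    seq y n + seq v n + ε                       ∎)
  (x≤y (½ * ε) (0<½ε 0<ε)) (u≤v (½ * ε) (0<½ε 0<ε))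
  where
  open ≤-Reasoning
  eq : ∀ p q ε → (p + ½ * ε) + (q + ½ * ε) ≡ p + q + ε
  eq = solve 3 (λ p q ε → (p :+ con ½ :* ε) :+ (q :+ con ½ :* ε) := p :+ q :+ ε) refl

+ʳ-cong : ∀ {x y u v} → x ≃ y → u ≃ v → x +ʳ u ≃ y +ʳ v
+ʳ-cong x≃y u≃v = ≼-antisym
  (+-mono-≼ (≼-reflexive x≃y) (≼-reflexive u≃v))
  (+-mono-≼ (≼-reflexive (≃-sym x≃y)) (≼-reflexive (≃-sym u≃v)))

-ʳ-cong : ∀ {x y} → x ≃ y → -ʳ x ≃ -ʳ y
-ʳ-cong {x} {y} (mk≃ x≈y) = mk≃ λ ε 0<ε → ev-map
  (λ n → subst (_< ε) (trans (sym (∣-p∣≡∣p∣ (seq x n - seq y n)))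
                             (cong ∣_∣ (eq (seq x n) (seq y n)))))
  (x≈y ε 0<ε)
  where
  eq : ∀ p q → - (p - q) ≡ - p - - q
  eq = solve 2 (λ p q → :- (p :- q) := :- p :- :- q) refl

*ʳ-congˡ : ∀ x {u v} → u ≃ v → x *ʳ u ≃ x *ʳ v
*ʳ-congˡ x {u} {v} (mk≃ u≈v) = mk≃ λ ε 0<ε → helper (eventually-bounded x) 0<ε
  where
  open ≤-Reasoning
  eq : ∀ p q r → p * q - p * r ≡ p * (q - r)
  eq = solve 3 (λ p q r → p :* q :- p :* r := p :* (q :- r)) refl
  scaled : ∀ {b ε} → EventuallyBoundedBy x b → (∃ λ r → 0ℚ < r × b * r ≡ ε) →
    Eventually λ n → ∣ seq x n * seq u n - seq x n * seq v n ∣ < ε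
  scaled {b} {ε} (0<b , x≤b) (r , 0<r , br≡ε) = ev-map₂
    (λ n h k → begin-strict
      ∣ seq x n * seq u n - seq x n * seq v n ∣  ≡⟨ cong ∣_∣ (eq (seq x n) (seq u n) (seq v n)) ⟩
      ∣ seq x n * (seq u n - seq v n) ∣          ≡⟨ ∣p*q∣≡∣p∣*∣q∣ (seq x n) (seq u n - seq v n) ⟩
      ∣ seq x n ∣ * ∣ seq u n - seq v n ∣
        ≤⟨ *-monoʳ-≤-nonNeg ∣ seq u n - seq v n ∣ {{∣-∣-nonNeg (seq u n - seq v n)}} h ⟩
      b * ∣ seq u n - seq v n ∣                  <⟨ *-monoʳ-<-pos b {{positive 0<b}} k ⟩
      b * r                                      ≡⟨ br≡ε ⟩
      ε                                          ∎)
    x≤b (u≈v r 0<r)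
  helper : ∀ {ε} → ∃ (EventuallyBoundedBy x) → 0ℚ < ε →
    Eventually λ n → ∣ seq x n * seq u n - seq x n * seq v n ∣ < ε
  helper (b , h) 0<ε = scaled h (divide (proj₁ h) 0<ε)

*ʳ-comm : ∀ x y → x *ʳ y ≃ y *ʳ x
*ʳ-comm x y = pointwise λ n → *-comm (seq x n) (seq y n)

*ʳ-cong : ∀ {x y u v} → x ≃ y → u ≃ v → x *ʳ u ≃ y *ʳ v
*ʳ-cong {x} {y} {u} {v} x≃y u≃v = ≃-trans (*ʳ-congˡ x u≃v)
  (≃-trans (*ʳ-comm x v) (≃-trans (*ʳ-congˡ v x≃y) (*ʳ-comm v y)))

ℝ-commutativeRing : CommutativeRing 0ℓ 0ℓ
ℝ-commutativeRing = record
  { Carrier = ℝ ; _≈_ = _≃_ ; _+_ = _+ʳ_ ; _*_ = _*ʳ_ ; -_ = -ʳ_ ; 0# = 0ʳ ; 1# = 1ʳ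
  ; isCommutativeRing = record
    { isRing = record
      { +-isAbelianGroup = record
        { isGroup = record
          { isMonoid = record
            { isSemigroup = record
              { isMagma = record
                { isEquivalence = record { refl = ≃-refl ; sym = ≃-sym ; trans = ≃-trans }
                ; ∙-cong = +ʳ-cong
                }
              ; assoc = λ x y z → pointwise λ n → +-assoc (seq x n) (seq y n) (seq z n)
              }
            ; identity = (λ x → pointwise λ n → +-identityˡ (seq x n))
                       , (λ x → pointwise λ n → +-identityʳ (seq x n))
            }
          ; inverse = (λ x → pointwise λ n → +-inverseˡ (seq x n))
                    , (λ x → pointwise λ n → +-inverseʳ (seq x n))
          ; ⁻¹-cong = -ʳ-cong
          }
        ; comm = λ x y → pointwise λ n → +-comm (seq x n) (seq y n)
        }
      ; *-cong = *ʳ-cong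
      ; *-assoc = λ x y z → pointwise λ n → *-assoc (seq x n) (seq y n) (seq z n)
      ; *-identity = (λ x → pointwise λ n → *-identityˡ (seq x n))
                   , (λ x → pointwise λ n → *-identityʳ (seq x n))
      ; distrib = (λ x y z → pointwise λ n → *-distribˡ-+ (seq x n) (seq y n) (seq z n))
                , (λ x y z → pointwise λ n → *-distribʳ-+ (seq x n) (seq y n) (seq z n))
      }
    ; *-comm = *ʳ-comm
    }
  }

≼-poset : Poset 0ℓ 0ℓ 0ℓ
≼-poset = record
  { isPartialOrder = record
    { isPreorder = record
      { isEquivalence = CommutativeRing.isEquivalence ℝ-commutativeRing
      ; reflexive = ≼-reflexive
      ; trans = ≼-trans
      }
    ; antisym = ≼-antisym
    }
  }

module ≼-Reasoning = PosetReasoning ≼-poset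

-- Multiplication by `z` magnifies the slack in `x ≤ y + r`, so `r` is taken as ε divided by an
-- eventual bound of `z`. Termwise nonnegativity lets the rational inequality be multiplied
-- directly.
*-monoˡ-≼ : ∀ {z} → PointwiseNonNeg z → ∀ {x y} → x ≼ y → z *ʳ x ≼ z *ʳ y
*-monoˡ-≼ {z} 0≤z {x} {y} (mk≼ x≤y) = mk≼ λ ε 0<ε → helper (eventually-bounded z) 0<ε
  where
  open ≤-Reasoning
  scaled : ∀ {b ε} → EventuallyBoundedBy z b → (∃ λ r → 0ℚ < r × b * r ≡ ε) →
    Eventually λ n → seq z n * seq x n ≤ seq z n * seq y n + ε
  scaled {b} {ε} (0<b , z≤b) (r , 0<r , br≡ε) = ev-map₂
    (λ n h k → begin
      seq z n * seq x n                ≤⟨ *-monoˡ-≤-nonNeg (seq z n) {{nonNegative (0≤z n)}} k ⟩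
      seq z n * (seq y n + r)          ≡⟨ *-distribˡ-+ (seq z n) (seq y n) r ⟩
      seq z n * seq y n + seq z n * r
        ≤⟨ +-monoʳ-≤ (seq z n * seq y n)
             (*-monoʳ-≤-nonNeg r {{nonNegative (<⇒≤ 0<r)}} (≤-trans (p≤∣p∣ (seq z n)) h)) ⟩
      seq z n * seq y n + b * r        ≡⟨ cong (seq z n * seq y n +_) br≡ε ⟩
      seq z n * seq y n + ε            ∎)
    z≤b (x≤y r 0<r)
  helper : ∀ {ε} → ∃ (EventuallyBoundedBy z) → 0ℚ < ε →
    Eventually λ n → seq z n * seq x n ≤ seq z n * seq y n + ε
  helper (b , h) 0<ε = scaled h (divide (proj₁ h) 0<ε)

square-zero : ∀ {x} → x *ʳ x ≼ 0ʳ → x ≃ 0ʳ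
square-zero {x} (mk≼ x²≤0) = mk≃ λ ε 0<ε → ev-map (λ n h →
  ≤-<-trans (square-cancel-≤ (<⇒≤ (0<½ε 0<ε)) (bound n (½ * ε) h)) (½ε<ε 0<ε))
  -- The tolerance for the square is the square of half of ε; the half leaves room for a strict
  -- inequality.
  (x²≤0 (½ * ε * (½ * ε)) (*-pos (0<½ε 0<ε) (0<½ε 0<ε)))
  where
  abs-square : ∀ p → ∣ p ∣ * ∣ p ∣ ≡ p * p
  abs-square p = trans (sym (∣p*q∣≡∣p∣*∣q∣ p p)) (0≤p⇒∣p∣≡p (square-nonNeg p))
  bound : ∀ n δ → seq x n * seq x n ≤ 0ℚ + δ * δ →
    ∣ seq x n - 0ℚ ∣ * ∣ seq x n - 0ℚ ∣ ≤ δ * δ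
  bound n δ h = subst₂ _≤_
    (sym (trans (cong (λ p → ∣ p ∣ * ∣ p ∣) (+-identityʳ (seq x n))) (abs-square (seq x n))))
    (+-identityˡ (δ * δ)) h

-- Letting t tend to 0.
quadratic-bound : ∀ {x y} → (∀ t → 0ℚ < t → x ≼ fromℚ t *ʳ (y +ʳ fromℚ t *ʳ x)) → x ≼ 0ʳ
quadratic-bound {x} {y} x≼ = mk≼ λ ε 0<ε →
  scaled (eventually-bounded x) (eventually-bounded y) (0<½ε 0<ε) (½ε+½ε≡ε ε)
  where
  Bound : ℚ → Set
  Bound δ = ∀ t → 0ℚ < t → Eventually λ n → seq x n ≤ t * (seq y n + t * seq x n) + δ
  small : ∀ {b c r δ ε} → EventuallyBoundedBy x b → EventuallyBoundedBy y c → Bound δ →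
    (c + b) * r ≡ δ → δ + δ ≡ ε →
    (∃ λ N → ∀ n → N ℕ.≤ n → ℤ.+ 1 / suc n ≤ r) →
    (∃ λ N → ∀ n → N ℕ.≤ n → ℤ.+ 1 / suc n ≤ 1ℚ) →
    Eventually λ n → seq x n ≤ 0ℚ + ε
  small {b} {c} {r} {δ} {ε} (0<b , x≤b) (0<c , y≤c) h eq δδ (M , hM) (N , hN) =
    ev-map₂ (λ n x∙y≤ p → begin
    seq x n                              ≤⟨ p ⟩
    t * (seq y n + t * seq x n) + δ
      ≤⟨ +-monoˡ-≤ δ (*-monoˡ-≤-nonNeg t {{nonNegative (<⇒≤ 0<t)}}
           (+-mono-≤ (≤-trans (p≤∣p∣ (seq y n)) (proj₂ x∙y≤)) (tx≤b n (proj₁ x∙y≤)))) ⟩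
    t * (c + b) + δ
      ≤⟨ +-monoˡ-≤ δ (*-monoʳ-≤-nonNeg (c + b) {{nonNegative (<⇒≤ (+-mono-< 0<c 0<b))}} t≤r) ⟩
    r * (c + b) + δ                      ≡⟨ cong (_+ δ) (trans (*-comm r (c + b)) eq) ⟩
    δ + δ                                ≡⟨ trans δδ (sym (+-identityˡ ε)) ⟩
    0ℚ + ε                               ∎)
    (ev-map₂ (λ _ → _,_) x≤b y≤c) (h t 0<t)
    where
    open ≤-Reasoning
    -- Being at most `r`, where `(c + b) * r ≡ δ`, this `t` makes the right-hand side at most `δ`;
    -- being at most 1, it keeps `t * seq x n` below `b`. The other `δ` is the slack of the
    -- hypothesis at this fixed `t`.
    t = ℤ.+ 1 / suc (M ℕ.⊔ N)
    t≤r = hM (M ℕ.⊔ N) (ℕ.m≤m⊔n M N)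
    t≤1 = hN (M ℕ.⊔ N) (ℕ.m≤n⊔m M N)
    0<t : 0ℚ < t
    0<t = positive⁻¹ t {{normalize-pos 1 (suc (M ℕ.⊔ N))}}
    tx≤b : ∀ n → ∣ seq x n ∣ ≤ b → t * seq x n ≤ b
    tx≤b n h = begin
      t * seq x n     ≤⟨ *-monoˡ-≤-nonNeg t {{nonNegative (<⇒≤ 0<t)}} (≤-trans (p≤∣p∣ (seq x n)) h) ⟩
      t * b           ≤⟨ *-monoʳ-≤-nonNeg b {{nonNegative (<⇒≤ 0<b)}} t≤1 ⟩
      1ℚ * b          ≡⟨ *-identityˡ b ⟩
      b               ∎
  scaled : ∀ {δ ε} → ∃ (EventuallyBoundedBy x) → ∃ (EventuallyBoundedBy y) → 0ℚ < δ →
    δ + δ ≡ ε → Eventually λ n → seq x n ≤ 0ℚ + ε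
  scaled {δ} (b , hb) (c , hc) 0<δ δδ =
    let r , 0<r , eq = divide (+-mono-< (proj₁ hc) (proj₁ hb)) 0<δ
    in small hb hc (λ t 0<t → un≼ (x≼ t 0<t) δ 0<δ) eq δδ
         (archimedean r 0<r) (archimedean 1ℚ (positive⁻¹ 1ℚ))

-- Square roots

√-nonNeg : ∀ x → PointwiseNonNeg (√ x)
√-nonNeg x n = root-nonNeg n (seq x n)

-- By `root-upper` the term of `x` lies below `(r + h)²`, with `r` the approximate root and `h` the
-- grid step. The excess `(2r + h) h` tends to 0 because the roots are eventually bounded and the
-- step shrinks.
≼-√² : ∀ x → x ≼ √ x *ʳ √ x
≼-√² x = mk≼ λ ε 0<ε → helper (eventually-bounded (√ x)) 0<ε
  where
  open ≤-Reasoning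
  eq : ∀ r h → (r + h) * (r + h) ≡ r * r + (r + r + h) * h
  eq = solve 2 (λ r h → (r :+ h) :* (r :+ h) := r :* r :+ (r :+ r :+ h) :* h) refl
  scaled : ∀ {b ε} → EventuallyBoundedBy (√ x) b →
    (∃ λ δ → 0ℚ < δ × (b + b + 1ℚ) * δ ≡ ε) →
    Eventually λ n → seq x n ≤ root n (seq x n) * root n (seq x n) + ε
  scaled {b} {ε} (0<b , r≤b) (δ , 0<δ , bδ≡ε) = ev-map₂ (λ n r≤b hs →
    let r = root n (seq x n)
        h = ℤ.+ 1 / suc n
        r≤ = ≤-trans (p≤∣p∣ r) r≤b
        0≤h = <⇒≤ (positive⁻¹ h {{normalize-pos 1 (suc n)}})
    in begin
    seq x n                     ≤⟨ <⇒≤ (root-upper n (seq x n)) ⟩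
    (r + h) * (r + h)           ≡⟨ eq r h ⟩
    r * r + (r + r + h) * h
      ≤⟨ +-monoʳ-≤ (r * r) (*-mono-≤-nonNeg
           (+-mono-≤ (+-mono-≤ (root-nonNeg n (seq x n)) (root-nonNeg n (seq x n))) 0≤h)
           (<⇒≤ 0<δ) (+-mono-≤ (+-mono-≤ r≤ r≤) (proj₁ hs)) (proj₂ hs)) ⟩
    r * r + (b + b + 1ℚ) * δ    ≡⟨ cong (r * r +_) bδ≡ε ⟩
    r * r + ε                   ∎)
    r≤b (ev-map₂ (λ _ → _,_) (archimedean 1ℚ (positive⁻¹ 1ℚ)) (archimedean δ 0<δ))
  helper : ∀ {ε} → ∃ (EventuallyBoundedBy (√ x)) → 0ℚ < ε →
    Eventually λ n → seq x n ≤ root n (seq x n) * root n (seq x n) + ε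
  helper (b , h) 0<ε =
    scaled h (divide (+-mono-< (+-mono-< (proj₁ h) (proj₁ h)) (positive⁻¹ 1ℚ)) 0<ε)

√²-≼ : ∀ {x} → 0ʳ ≼ x → √ x *ʳ √ x ≼ x
√²-≼ {x} (mk≼ 0≤x) = mk≼ λ ε 0<ε → ev-map (λ n h → bound n h 0<ε (root-lower n (seq x n))) (0≤x ε 0<ε)
  where
  bound : ∀ n {ε r} → 0ℚ ≤ seq x n + ε → 0ℚ < ε → r ≡ 0ℚ ⊎ r * r ≤ seq x n → r * r ≤ seq x n + ε
  -- The root may have its default value 0, in particular where the term of `x` is negative; what is
  -- then required is exactly that the term is at least minus ε.
  bound n h 0<ε (inj₁ refl) = h
  bound n {ε} {r} h 0<ε (inj₂ r²≤x) = subst (_≤ seq x n + ε) (+-identityʳ (r * r))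
    (+-mono-≤ r²≤x (<⇒≤ 0<ε))

√-square : ∀ {x} → 0ʳ ≼ x → √ x *ʳ √ x ≃ x
√-square {x} 0≼x = ≼-antisym (√²-≼ 0≼x) (≼-√² x)

square-mono-≼ : ∀ {x y} → PointwiseNonNeg x → PointwiseNonNeg y → x ≼ y → x *ʳ x ≼ y *ʳ y
square-mono-≼ {x} {y} 0≤x 0≤y x≼y = ≼-trans (*-monoˡ-≼ 0≤x x≼y)
  (≼-trans (≼-reflexive (*ʳ-comm x y)) (*-monoˡ-≼ 0≤y x≼y))

-- The squares are compared with tolerance `ε * ε`, which is absorbed by `y² + ε² ≤ (y + ε)²` for
-- nonnegative terms of `y`; the rational cancellation law then applies.
square-cancel-≼ : ∀ {x y} → PointwiseNonNeg y → x *ʳ x ≼ y *ʳ y → x ≼ y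
square-cancel-≼ {x} {y} 0≤y (mk≼ x²≤y²) = mk≼ λ ε 0<ε → ev-map
  (λ n h → square-cancel-≤ (+-mono-≤ (0≤y n) (<⇒≤ 0<ε)) (begin
    seq x n * seq x n                              ≤⟨ h ⟩
    seq y n * seq y n + ε * ε                      ≡⟨ sym (+-identityʳ (seq y n * seq y n + ε * ε)) ⟩
    seq y n * seq y n + ε * ε + 0ℚ
      ≤⟨ +-monoʳ-≤ (seq y n * seq y n + ε * ε)
           (+-mono-≤ (*-nonNeg (0≤y n) (<⇒≤ 0<ε)) (*-nonNeg (0≤y n) (<⇒≤ 0<ε))) ⟩
    seq y n * seq y n + ε * ε + (seq y n * ε + seq y n * ε)   ≡⟨ eq (seq y n) ε ⟩
    (seq y n + ε) * (seq y n + ε)                  ∎))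
  (x²≤y² (ε * ε) (*-pos 0<ε 0<ε))
  where
  open ≤-Reasoning
  eq : ∀ p ε → p * p + ε * ε + (p * ε + p * ε) ≡ (p + ε) * (p + ε)
  eq = solve 2 (λ p ε → p :* p :+ ε :* ε :+ (p :* ε :+ p :* ε) := (p :+ ε) :* (p :+ ε)) refl

√-mono-≼ : ∀ {x y} → 0ʳ ≼ x → x ≼ y → √ x ≼ √ y
√-mono-≼ {x} {y} 0≼x x≼y = square-cancel-≼ (√-nonNeg y)
  (≼-trans (√²-≼ 0≼x) (≼-trans x≼y (≼-√² y)))

√-cancel-≼ : ∀ {x y} → 0ʳ ≼ y → √ x ≼ √ y → x ≼ y
√-cancel-≼ {x} {y} 0≼y √x≼√y = ≼-trans (≼-√² x)
  (≼-trans (square-mono-≼ (√-nonNeg x) (√-nonNeg y) √x≼√y) (√²-≼ 0≼y))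

fromℚ-square : ∀ q → fromℚ q *ʳ fromℚ q ≃ fromℚ (q * q)
fromℚ-square q = pointwise λ _ → refl

√≃1⇒≃1 : ∀ {x} → 0ʳ ≼ x → √ x ≃ 1ʳ → x ≃ 1ʳ
√≃1⇒≃1 0≼x √x≃1 = ≃-trans (≃-sym (√-square 0≼x)) (≃-trans (*ʳ-cong √x≃1 √x≃1) (fromℚ-square 1ℚ))

≃1⇒√≃1 : ∀ {x} → x ≃ 1ʳ → √ x ≃ 1ʳ
≃1⇒√≃1 {x} x≃1 = ≼-antisym
  (square-cancel-≼ (λ _ → <⇒≤ (positive⁻¹ 1ℚ))
    (≼-trans (√²-≼ 0≼x) (≼-reflexive (≃-trans x≃1 (≃-sym (fromℚ-square 1ℚ))))))
  (square-cancel-≼ (√-nonNeg x)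
    (≼-trans (≼-reflexive (≃-trans (fromℚ-square 1ℚ) (≃-sym x≃1))) (≼-√² x)))
  where
  0≼x : 0ʳ ≼ x
  0≼x = ≼-trans (pointwise-≼ (λ _ → <⇒≤ (positive⁻¹ 1ℚ))) (≼-reflexive (≃-sym x≃1))

module ℝ-ring = CommutativeRing ℝ-commutativeRing
module ℝΣ = SemiringSum ℝ-ring.semiring

-- Sums of reals

sum-nonNeg : ∀ {n} {f : Fin n → ℝ} → (∀ i → PointwiseNonNeg (f i)) → PointwiseNonNeg (sumʳ f)
sum-nonNeg {zero}  0≤f n = ≤-refl
sum-nonNeg {suc _} 0≤f n = +-mono-≤ (0≤f zero n) (sum-nonNeg (λ i → 0≤f (suc i)) n)

sum-mono-≼ : ∀ {n} {f g : Fin n → ℝ} → (∀ i → f i ≼ g i) → sumʳ f ≼ sumʳ g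
sum-mono-≼ {zero}  f≼g = ≼-reflexive ≃-refl
sum-mono-≼ {suc n} f≼g = +-mono-≼ (f≼g zero) (sum-mono-≼ λ i → f≼g (suc i))

summand-≤-sum : ∀ {n} {f : Fin n → ℝ} → (∀ i → PointwiseNonNeg (f i)) →
  ∀ i n → seq (f i) n ≤ seq (sumʳ f) n
summand-≤-sum {f = f} 0≤f zero n = subst (_≤ seq (sumʳ f) n) (+-identityʳ (seq (f zero) n))
  (+-monoʳ-≤ (seq (f zero) n) (sum-nonNeg (λ i → 0≤f (suc i)) n))
summand-≤-sum {f = f} 0≤f (suc i) n = subst (_≤ seq (sumʳ f) n) (+-identityˡ (seq (f (suc i)) n))
  (+-mono-≤ (0≤f zero n) (summand-≤-sum (λ i → 0≤f (suc i)) i n))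

summand-zero : ∀ {n} {f : Fin n → ℝ} → (∀ i → PointwiseNonNeg (f i)) → sumʳ f ≼ 0ʳ → ∀ i → f i ≼ 0ʳ
summand-zero {f = f} 0≤f Σ≼0 i = ≼-trans (pointwise-≼ (summand-≤-sum {f = f} 0≤f i)) Σ≼0

nonNeg⇒0≼ : ∀ {x} → PointwiseNonNeg x → 0ʳ ≼ x
nonNeg⇒0≼ = pointwise-≼

-- Complex numbers

infix 4 _≅_

record _≅_ (z w : ℂ) : Set where
  constructor _,ᶜ_
  field
    re-≅ : re z ≃ re w
    im-≅ : im z ≃ im w
open _≅_ public

from≈ : ∀ {z w} → z ≈ w → z ≅ w
from≈ (p , q) = mk≃ p ,ᶜ mk≃ q

to≈ : ∀ {z w} → z ≅ w → z ≈ w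
to≈ (mk≃ p ,ᶜ mk≃ q) = p , q

pointwiseᶜ : ∀ {z w} → (∀ n → seq (re z) n ≡ seq (re w) n) → (∀ n → seq (im z) n ≡ seq (im w) n) →
  z ≅ w
pointwiseᶜ p q = pointwise p ,ᶜ pointwise q

-ᶜ_ : ℂ → ℂ
-ᶜ z = (-ʳ re z) +i (-ʳ im z)

*ᶜ-assoc : ∀ x y z → (x *ᶜ y) *ᶜ z ≅ x *ᶜ (y *ᶜ z)
*ᶜ-assoc (a +i b) (c +i d) (e +i f) = pointwiseᶜ
  (λ n → solve 6 (λ a b c d e f →
     (a :* c :+ :- (b :* d)) :* e :+ :- ((a :* d :+ b :* c) :* f) :=
     a :* (c :* e :+ :- (d :* f)) :+ :- (b :* (c :* f :+ d :* e))) refl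
     (seq a n) (seq b n) (seq c n) (seq d n) (seq e n) (seq f n))
  (λ n → solve 6 (λ a b c d e f →
     (a :* c :+ :- (b :* d)) :* f :+ (a :* d :+ b :* c) :* e :=
     a :* (c :* f :+ d :* e) :+ b :* (c :* e :+ :- (d :* f))) refl
     (seq a n) (seq b n) (seq c n) (seq d n) (seq e n) (seq f n))

*ᶜ-comm : ∀ x y → x *ᶜ y ≅ y *ᶜ x
*ᶜ-comm (a +i b) (c +i d) = pointwiseᶜ
  (λ n → solve 4 (λ a b c d → a :* c :+ :- (b :* d) := c :* a :+ :- (d :* b)) refl
     (seq a n) (seq b n) (seq c n) (seq d n))
  (λ n → solve 4 (λ a b c d → a :* d :+ b :* c := c :* b :+ d :* a) refl
     (seq a n) (seq b n) (seq c n) (seq d n))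

*ᶜ-identityˡ : ∀ x → fromℝ 1ʳ *ᶜ x ≅ x
*ᶜ-identityˡ (a +i b) = pointwiseᶜ
  (λ n → solve 2 (λ a b → con 1ℚ :* a :+ :- (con 0ℚ :* b) := a) refl (seq a n) (seq b n))
  (λ n → solve 2 (λ a b → con 1ℚ :* b :+ con 0ℚ :* a := b) refl (seq a n) (seq b n))

*ᶜ-distribˡ : ∀ x y z → x *ᶜ (y +ᶜ z) ≅ x *ᶜ y +ᶜ x *ᶜ z
*ᶜ-distribˡ (a +i b) (c +i d) (e +i f) = pointwiseᶜ
  (λ n → solve 6 (λ a b c d e f →
     a :* (c :+ e) :+ :- (b :* (d :+ f)) :=
     (a :* c :+ :- (b :* d)) :+ (a :* e :+ :- (b :* f))) refl
     (seq a n) (seq b n) (seq c n) (seq d n) (seq e n) (seq f n))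
  (λ n → solve 6 (λ a b c d e f →
     a :* (d :+ f) :+ b :* (c :+ e) :=
     (a :* d :+ b :* c) :+ (a :* f :+ b :* e)) refl
     (seq a n) (seq b n) (seq c n) (seq d n) (seq e n) (seq f n))

≅-trans : ∀ {x y z} → x ≅ y → y ≅ z → x ≅ z
≅-trans (p ,ᶜ q) (r ,ᶜ s) = ≃-trans p r ,ᶜ ≃-trans q s

+ᶜ-cong : ∀ {x y u v} → x ≅ y → u ≅ v → x +ᶜ u ≅ y +ᶜ v
+ᶜ-cong (p ,ᶜ q) (r ,ᶜ s) = +ʳ-cong p r ,ᶜ +ʳ-cong q s

*ᶜ-cong : ∀ {x y u v} → x ≅ y → u ≅ v → x *ᶜ u ≅ y *ᶜ v
*ᶜ-cong (p ,ᶜ q) (r ,ᶜ s) =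
  +ʳ-cong (*ʳ-cong p r) (-ʳ-cong (*ʳ-cong q s)) ,ᶜ +ʳ-cong (*ʳ-cong p s) (*ʳ-cong q r)

ℂ-commutativeRing : CommutativeRing 0ℓ 0ℓ
ℂ-commutativeRing = record
  { Carrier = ℂ ; _≈_ = _≅_ ; _+_ = _+ᶜ_ ; _*_ = _*ᶜ_ ; -_ = -ᶜ_ ; 0# = 0ᶜ ; 1# = fromℝ 1ʳ
  ; isCommutativeRing = record
    { isRing = record
      { +-isAbelianGroup = record
        { isGroup = record
          { isMonoid = record
            { isSemigroup = record
              { isMagma = record
                { isEquivalence = record
                  { refl = ≃-refl ,ᶜ ≃-refl
                  ; sym = λ (p ,ᶜ q) → ≃-sym p ,ᶜ ≃-sym q
                  ; trans = ≅-trans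
                  }
                ; ∙-cong = +ᶜ-cong
                }
              ; assoc = λ (a +i b) (c +i d) (e +i f) → ℝ-ring.+-assoc a c e ,ᶜ ℝ-ring.+-assoc b d f
              }
            ; identity = (λ (a +i b) → ℝ-ring.+-identityˡ a ,ᶜ ℝ-ring.+-identityˡ b)
                       , (λ (a +i b) → ℝ-ring.+-identityʳ a ,ᶜ ℝ-ring.+-identityʳ b)
            }
          ; inverse = (λ (a +i b) → ℝ-ring.-‿inverseˡ a ,ᶜ ℝ-ring.-‿inverseˡ b)
                    , (λ (a +i b) → ℝ-ring.-‿inverseʳ a ,ᶜ ℝ-ring.-‿inverseʳ b)
          ; ⁻¹-cong = λ (p ,ᶜ q) → -ʳ-cong p ,ᶜ -ʳ-cong q
          }
        ; comm = λ (a +i b) (c +i d) → ℝ-ring.+-comm a c ,ᶜ ℝ-ring.+-comm b d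
        }
      ; *-cong = *ᶜ-cong
      ; *-assoc = *ᶜ-assoc
      ; *-identity = *ᶜ-identityˡ , λ x → ≅-trans (*ᶜ-comm x (fromℝ 1ʳ)) (*ᶜ-identityˡ x)
      ; distrib = *ᶜ-distribˡ , λ x y z → ≅-trans (*ᶜ-comm (y +ᶜ z) x)
          (≅-trans (*ᶜ-distribˡ x y z) (+ᶜ-cong (*ᶜ-comm x y) (*ᶜ-comm x z)))
      }
    ; *-comm = *ᶜ-comm
    }
  }

conj-isInvolution : IsInvolution ℂ-commutativeRing conj
conj-isInvolution = record
  { isRingHomomorphism = record
    { isSemiringHomomorphism = record
      { isNearSemiringHomomorphism = record
        { +-isMonoidHomomorphism = record
          { isMagmaHomomorphism = record
            { isRelHomomorphism = record { cong = λ (p ,ᶜ q) → p ,ᶜ -ʳ-cong q }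
            ; homo = λ (a +i b) (c +i d) → ≃-refl ,ᶜ
                pointwise (λ n → neg-distrib-+ (seq b n) (seq d n))
            }
          ; ε-homo = pointwiseᶜ (λ _ → refl) (λ _ → refl)
          }
        ; *-homo = λ (a +i b) (c +i d) → pointwiseᶜ
            (λ n → solve 4 (λ a b c d → a :* c :+ :- (b :* d) := a :* c :+ :- (:- b :* :- d)) refl
               (seq a n) (seq b n) (seq c n) (seq d n))
            (λ n → solve 4 (λ a b c d → :- (a :* d :+ b :* c) := a :* :- d :+ :- b :* c) refl
               (seq a n) (seq b n) (seq c n) (seq d n))
        }
      ; 1#-homo = pointwiseᶜ (λ _ → refl) (λ _ → refl)
      }
    ; -‿homo = λ _ → ≃-refl ,ᶜ ≃-refl
    }
  ; involutive = λ (a +i b) → ≃-refl ,ᶜ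
      pointwise (λ n → solve 1 (λ b → :- :- b := b) refl (seq b n))
  }

module ℂ-ring = CommutativeRing ℂ-commutativeRing
module conj = IsInvolution conj-isInvolution
module ℂΣ = SemiringSum ℂ-ring.semiring
open StarAlgebra ℂ-commutativeRing conj conj-isInvolution

-- Moduli, squared norms and quadratic forms

fromℝ-cong : ∀ {x y} → x ≃ y → fromℝ x ≅ fromℝ y
fromℝ-cong x≃y = x≃y ,ᶜ ≃-refl

fromℝ-* : ∀ x y → fromℝ x *ᶜ fromℝ y ≅ fromℝ (x *ʳ y)
fromℝ-* a b = pointwiseᶜ
  (λ n → solve 2 (λ a b → a :* b :+ :- (con 0ℚ :* con 0ℚ) := a :* b) refl (seq a n) (seq b n))
  (λ n → solve 2 (λ a b → a :* con 0ℚ :+ con 0ℚ :* b := con 0ℚ) refl (seq a n) (seq b n))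

fromℝ-sum : ∀ {n} (f : Fin n → ℝ) → sumᶜ (λ i → fromℝ (f i)) ≅ fromℝ (sumʳ f)
fromℝ-sum {zero}  f = ℂ-ring.refl
fromℝ-sum {suc n} f = ≅-trans (ℂ-ring.+-congˡ (fromℝ-sum λ i → f (suc i)))
  (≃-refl ,ᶜ ℝ-ring.+-identityʳ 0ʳ)

z*conj-z : ∀ z → z *ᶜ conj z ≅ fromℝ ∣ z ∣²
z*conj-z (a +i b) = pointwiseᶜ
  (λ n → solve 2 (λ a b → a :* a :+ :- (b :* :- b) := a :* a :+ b :* b) refl (seq a n) (seq b n))
  (λ n → solve 2 (λ a b → a :* :- b :+ b :* a := con 0ℚ) refl (seq a n) (seq b n))

∣z∣²-nonNeg : ∀ z → PointwiseNonNeg ∣ z ∣²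
∣z∣²-nonNeg (a +i b) n = +-mono-≤ (square-nonNeg (seq a n)) (square-nonNeg (seq b n))

∣z∣²≼0⇒z≅0 : ∀ {z} → ∣ z ∣² ≼ 0ʳ → z ≅ 0ᶜ
∣z∣²≼0⇒z≅0 {a +i b} h =
  square-zero (≼-trans (pointwise-≼ λ n → subst (_≤ seq a n * seq a n + seq b n * seq b n)
    (+-identityʳ (seq a n * seq a n)) (+-monoʳ-≤ (seq a n * seq a n) (square-nonNeg (seq b n)))) h) ,ᶜ
  square-zero (≼-trans (pointwise-≼ λ n → subst (_≤ seq a n * seq a n + seq b n * seq b n)
    (+-identityˡ (seq b n * seq b n)) (+-monoˡ-≤ (seq b n * seq b n) (square-nonNeg (seq a n)))) h)

∣∣²-cong : ∀ {z w} → z ≅ w → ∣ z ∣² ≃ ∣ w ∣²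
∣∣²-cong (p ,ᶜ q) = +ʳ-cong (*ʳ-cong p p) (*ʳ-cong q q)

module _ {n : ℕ} where

  normSq : ℂ^ n → ℝ
  normSq x = sumʳ λ i → ∣ x i ∣²

  normSq-nonNeg : ∀ x → PointwiseNonNeg (normSq x)
  normSq-nonNeg x = sum-nonNeg {f = λ i → ∣ x i ∣²} (λ i → ∣z∣²-nonNeg (x i))

  inner-self : ∀ x → ⟪ x , x ⟫ ≅ fromℝ (normSq x)
  inner-self x = ≅-trans (ℂΣ.sum-cong-≋ λ i → z*conj-z (x i)) (fromℝ-sum λ i → ∣ x i ∣²)

-- The trace is the sum of the squared moduli of all entries, each of them termwise nonnegative, so
-- every summand is squeezed to 0.
frobenius-definite : ∀ {m n} (A : Mat m n) → tr (A † ⊗ A) ≅ 0ᶜ → ∀ i j → A i j ≅ 0ᶜ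
frobenius-definite A h i j = ∣z∣²≼0⇒z≅0 (summand-zero
  {f = λ i → ∣ A i j ∣²} (λ i → ∣z∣²-nonNeg (A i j))
  (summand-zero {f = λ j → normSq (λ i → A i j)} (λ j → normSq-nonNeg (λ i → A i j))
    (≼-reflexive (re-≅ (≅-trans (ℂ-ring.sym trace≅) h))) j) i)
  where
  trace≅ : tr (A † ⊗ A) ≅ fromℝ (sumʳ λ j → normSq (λ i → A i j))
  trace≅ = ≅-trans
    (ℂΣ.sum-cong-≋ λ j → ≅-trans
      (ℂΣ.sum-cong-≋ λ i → ℂ-ring.*-comm (conj (A i j)) (A i j)) (inner-self (λ i → A i j)))
    (fromℝ-sum λ j → normSq (λ i → A i j))

-- Since `α` and `β` are constant rational sequences, the two sides agree at every index as
-- polynomials over `ℚ`; `go` adds one coordinate at a time.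
normSq-combination : ∀ {n} α β (x y : ℂ^ n) →
  normSq (fromℝ (fromℚ α) ∙ x ⊞ fromℝ (fromℚ β) ∙ y) ≃
  fromℚ (α * α) *ʳ normSq x +ʳ fromℚ (α * β) *ʳ (re ⟪ x , y ⟫ +ʳ re ⟪ x , y ⟫)
    +ʳ fromℚ (β * β) *ʳ normSq y
normSq-combination α β x y = pointwise (go x y)
  where
  go : ∀ {n} (x y : ℂ^ n) m → seq (normSq (fromℝ (fromℚ α) ∙ x ⊞ fromℝ (fromℚ β) ∙ y)) m ≡
    α * α * seq (normSq x) m + α * β * (seq (re ⟪ x , y ⟫) m + seq (re ⟪ x , y ⟫) m)
      + β * β * seq (normSq y) m
  go {zero} x y m = solve 2 (λ α β → con 0ℚ :=
    α :* α :* con 0ℚ :+ α :* β :* (con 0ℚ :+ con 0ℚ) :+ β :* β :* con 0ℚ) refl α β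
  go {suc n} x y m = trans (cong (seq ∣ (fromℝ (fromℚ α) ∙ x ⊞ fromℝ (fromℚ β) ∙ y) zero ∣² m +_)
    (go (λ i → x (suc i)) (λ i → y (suc i)) m))
    (solve 9 (λ α β a b c d X r Y →
      let u = (α :* a :+ :- (con 0ℚ :* b)) :+ (β :* c :+ :- (con 0ℚ :* d))
          v = (α :* b :+ con 0ℚ :* a) :+ (β :* d :+ con 0ℚ :* c)
          s = (a :* c :+ :- (b :* :- d)) :+ r
      in (u :* u :+ v :* v) :+ (α :* α :* X :+ α :* β :* (r :+ r) :+ β :* β :* Y) :=
         α :* α :* ((a :* a :+ b :* b) :+ X) :+ α :* β :* (s :+ s)
           :+ β :* β :* ((c :* c :+ d :* d) :+ Y)) refl
      α β (seq (re (x zero)) m) (seq (im (x zero)) m) (seq (re (y zero)) m) (seq (im (y zero)) m)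
      (seq (normSq (λ i → x (suc i))) m) (seq (re ⟪ (λ i → x (suc i)) , (λ i → y (suc i)) ⟫) m)
      (seq (normSq (λ i → y (suc i))) m))

-- The quadratic form l α² + 2 r α β + w β² is maximal on the unit circle at (1, 0), so its
-- derivative 2 r there cannot be positive; the points used are ((1 - t²)/(1 + t²), 2t/(1 + t²)).
tangent-bound : ∀ {l r w} → PointwiseNonNeg w →
  (∀ α β → α * α + β * β ≡ 1ℚ →
     fromℚ (α * α) *ʳ l +ʳ fromℚ (α * β) *ʳ (r +ʳ r) +ʳ fromℚ (β * β) *ʳ w ≼ l) →
  r ≼ 0ʳ
tangent-bound {l} {r} {w} 0≤w form≼l = quadratic-bound λ t 0<t →
  bound t 0<t (divide (+-mono-≤-< (square-nonNeg t) (positive⁻¹ 1ℚ)) (positive⁻¹ 1ℚ))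
    (divide (+-mono-< (+-mono-< 0<t 0<t) (+-mono-< 0<t 0<t)) (positive⁻¹ 1ℚ))
  where
  bound : ∀ t → 0ℚ < t → (∃ λ c → 0ℚ < c × (t * t + 1ℚ) * c ≡ 1ℚ) →
    (∃ λ e → 0ℚ < e × ((t + t) + (t + t)) * e ≡ 1ℚ) →
    r ≼ fromℚ t *ʳ (l +ʳ fromℚ t *ʳ r)
  bound t 0<t (c , 0<c , sc≡1) (e , 0<e , 4te≡1) =
    ≼-trans (≼-reflexive (pointwise r≡))
      (≼-trans (+-mono-≼ (*-monoˡ-≼ {fromℚ d} (λ _ → 0≤d) (form≼l α β α²+β²≡1))
                         (≼-reflexive (≃-refl {x = Z})))
        (pointwise-≼ rest))
    where
    s = t * t + 1ℚ
    α = (1ℚ - t * t) * c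
    β = (t + t) * c
    -- Here `c` is `1/(1 + t²)` and `e` is `1/(4t)`. Multiplying the inequality between the form and
    -- `l` by `d` clears the denominators and leaves `(1 - t²) r + t w ≼ t l`; dropping the
    -- nonnegative `t w` gives `r ≼ t (l + t r)`.
    d = s * s * e
    0≤d : 0ℚ ≤ d
    0≤d = *-nonNeg (square-nonNeg s) (<⇒≤ 0<e)
    α²+β²≡1 : α * α + β * β ≡ 1ℚ
    α²+β²≡1 = trans (solve 2 (λ t c →
      let α = (con 1ℚ :- t :* t) :* c
          β = (t :+ t) :* c
          s = t :* t :+ con 1ℚ
      in α :* α :+ β :* β := (s :* c) :* (s :* c)) refl t c) (cong₂ _*_ sc≡1 sc≡1)
    f = (t + t) * (t + t) * e
    g = (1ℚ - t * t) * (1ℚ - t * t) * e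
    -- The remainder for which `r` equals `d` times the form plus `Z`, so that the bound on the form
    -- can be inserted additively. Up to `4te≡1`, `f` is `t` and `g` is `(1 - t²)²/(4t)`.
    Z : ℝ
    Z = fromℚ (f * t) *ʳ r +ʳ -ʳ (fromℚ g *ʳ l +ʳ fromℚ f *ʳ w)
    r≡ : ∀ n → seq r n ≡ d * (α * α * seq l n + α * β * (seq r n + seq r n) + β * β * seq w n) + seq Z n
    -- The solver treats `c` and `e` as free variables, so the identity is first written with
    -- `s * c` and `4 t e` as explicit factors; only then are both replaced by 1.
    r≡ n = sym (trans
      (solve 6 (λ t c e l r w →
        let s = t :* t :+ con 1ℚ
            p = con 1ℚ :- t :* t
            q = t :+ t
            α = p :* c
            β = q :* c
            f = q :* q :* e
            g = p :* p :* e
        in (s :* s :* e) :* (α :* α :* l :+ α :* β :* (r :+ r) :+ β :* β :* w)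
             :+ (f :* t :* r :+ :- (g :* l :+ f :* w)) :=
           ((s :* c) :* (s :* c) :- con 1ℚ) :* (e :* (p :* p :* l :+ p :* q :* (r :+ r) :+ q :* q :* w))
             :+ ((q :+ q) :* e) :* r) refl t c e (seq l n) (seq r n) (seq w n))
      (trans (cong₂ (λ u v → (u * u - 1ℚ) * X + v * seq r n) sc≡1 4te≡1)
        (solve 2 (λ X r → (con 1ℚ :* con 1ℚ :- con 1ℚ) :* X :+ con 1ℚ :* r := r) refl X (seq r n))))
      where
      X = e * ((1ℚ - t * t) * (1ℚ - t * t) * seq l n + (1ℚ - t * t) * (t + t) * (seq r n + seq r n)
            + (t + t) * (t + t) * seq w n)
    rest : ∀ n → d * seq l n + seq Z n ≤ t * (seq l n + t * seq r n)
    rest n = begin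
      d * seq l n + seq Z n                       ≡⟨ sym (+-identityʳ (d * seq l n + seq Z n)) ⟩
      d * seq l n + seq Z n + 0ℚ
        ≤⟨ +-monoʳ-≤ (d * seq l n + seq Z n)
             (*-nonNeg (*-nonNeg (square-nonNeg (t + t)) (<⇒≤ 0<e)) (0≤w n)) ⟩
      d * seq l n + seq Z n + f * seq w n
        ≡⟨ solve 5 (λ t e l r w →
             let s = t :* t :+ con 1ℚ
                 p = con 1ℚ :- t :* t
                 q = t :+ t
                 f = q :* q :* e
                 g = p :* p :* e
             in (s :* s :* e) :* l :+ (f :* t :* r :+ :- (g :* l :+ f :* w)) :+ f :* w :=
                ((q :+ q) :* e) :* (t :* (l :+ t :* r))) refl t e (seq l n) (seq r n) (seq w n) ⟩
      ((t + t) + (t + t)) * e * (t * (seq l n + t * seq r n))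
        ≡⟨ cong (_* (t * (seq l n + t * seq r n))) 4te≡1 ⟩
      1ℚ * (t * (seq l n + t * seq r n))          ≡⟨ *-identityˡ (t * (seq l n + t * seq r n)) ⟩
      t * (seq l n + t * seq r n)                 ∎
      where open ≤-Reasoning

-- Concentration operators

-- Over `ℂ` the abstract products, adjoint and inner product unfold to those of the definitions. The
-- identity matrix needs a bridge: `I` embeds a real conditional, while `𝟙` chooses between complex
-- units.
I≅𝟙 : ∀ {n} (i j : Fin n) → I i j ≅ 𝟙 i j
I≅𝟙 i j with i Fin.≟ j
... | yes _ = ℂ-ring.refl
... | no  _ = ℂ-ring.refl

indicatorDiag-isProjection : ∀ {n} (S : Subset n) → IsProjection (indicatorDiag S)
indicatorDiag-isProjection S = IsProjection-resp select≋ (select-isProjection (λ i → ⌊ i ∈? S ⌋))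
  where
  select≋ : select (λ i → ⌊ i ∈? S ⌋) ≋ indicatorDiag S
  select≋ i j with ⌊ i ∈? S ⌋
  ... | true  = ℂ-ring.sym (I≅𝟙 i j)
  ... | false = ℂ-ring.refl

-- From the rank hypothesis to the expansion in the given orthonormal family

module _ {N K : ℕ} (U : Matrix N) (unitary : Unitary U) (S F : Subset N)
  (rank : HasRank (B U F) K) (ψ : Fin K → ℂ^ N) (orthonormal : Orthonormal ψ)
  (bandLimited : ∀ i → BandLimited U F (ψ i)) where

  private
    P : Matrix N
    P = B U F

    projP : IsProjection P
    projP = conjugate-isProjection
      (λ i j → ℂ-ring.trans (from≈ (proj₁ unitary i j)) (I≅𝟙 i j)) (indicatorDiag-isProjection F)

    projD : IsProjection (D S)
    projD = indicatorDiag-isProjection S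

    ψ-orthonormal : ∀ i j → ⟪ ψ i , ψ j ⟫ ≅ 𝟙 i j
    ψ-orthonormal i j = ℂ-ring.trans (from≈ (orthonormal i j)) (I≅𝟙 i j)

    ψ-fixed : ∀ i → P ▹ ψ i ≋ᵛ ψ i
    ψ-fixed i l = from≈ (bandLimited i l)

    v : Fin K → ℂ^ N
    v = proj₁ rank

    coordinates : ∀ j → ∃ λ c → combination c v ≈ᵛ λ i → P i j
    coordinates j = proj₂ (proj₂ (proj₂ rank)) (λ i → P i j)
      -- The `j`-th column of `P` is the image of the `j`-th standard basis vector, hence in the
      -- range.
      ((λ i → 𝟙 i j) , λ i → to≈ (⊗-identityʳ P i j))

    W : Mat K N
    W k j = proj₁ (coordinates j) k

    P≋VW : P ≋ columns v ⊗ W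
    P≋VW i j = ℂ-ring.sym (ℂ-ring.trans (columns-⊗ v W i j) (from≈ (proj₂ (coordinates j) i)))

    PV≋V : P ⊗ columns v ≋ columns v
    PV≋V i j = let x , Px≈v = proj₁ (proj₂ rank) j in begin
      (P ▹ v j) i        ≈⟨ ▹-congˡ P (λ l → from≈ (Px≈v l)) i ⟨
      (P ▹ (P ▹ x)) i    ≈⟨ ▹-idempotent projP x i ⟩
      (P ▹ x) i          ≈⟨ from≈ (Px≈v i) ⟩
      v j i              ∎
      where open SetoidReasoning ℂ-ring.setoid

    -- The columns of `v` lie in the range of an idempotent and are therefore fixed by `P`, which is
    -- `columns v ⊗ W`. Thus `W ⊗ columns v` and `𝟙` agree after multiplication by `columns v`, and
    -- independence cancels it.
    WV≋𝟙 : W ⊗ columns v ≋ 𝟙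
    WV≋𝟙 = independent-cancelˡ
      (λ c h k → from≈ (proj₁ (proj₂ (proj₂ rank)) c (λ i → to≈ (h i)) k)) (begin
      columns v ⊗ (W ⊗ columns v)  ≈⟨ ⊗-assoc (columns v) W (columns v) ⟨
      columns v ⊗ W ⊗ columns v    ≈⟨ ⊗-congʳ (columns v) P≋VW ⟨
      P ⊗ columns v                ≈⟨ PV≋V ⟩
      columns v                    ≈⟨ ⊗-identityʳ (columns v) ⟨
      columns v ⊗ 𝟙                ∎)
      where open SetoidReasoning (matSetoid N K)

    Ψ†Ψ≋𝟙 : columns ψ † ⊗ columns ψ ≋ 𝟙
    Ψ†Ψ≋𝟙 i j = begin
      (columns ψ † ⊗ columns ψ) i j
        ≈⟨ ℂΣ.sum-cong-≋ (λ l → ℂ-ring.*-comm (conj (ψ i l)) (ψ j l)) ⟩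
      ⟪ ψ j , ψ i ⟫         ≈⟨ ψ-orthonormal j i ⟩
      𝟙 j i                 ≈⟨ 𝟙-sym j i ⟩
      𝟙 i j                 ∎
      where open SetoidReasoning ℂ-ring.setoid

    resolution : P ≋ columns ψ ⊗ columns ψ †
    resolution i j = begin
      P i j                       ≈⟨ ℂ-ring.+-identityʳ (P i j) ⟨
      P i j +ᶜ 0ᶜ                 ≈⟨ ℂ-ring.+-congˡ (ℂ-ring.-‿inverseˡ (Q i j)) ⟨
      P i j +ᶜ (-ᶜ Q i j +ᶜ Q i j) ≈⟨ ℂ-ring.+-assoc (P i j) (-ᶜ Q i j) (Q i j) ⟨
      (P ⊖ Q) i j +ᶜ Q i j
        ≈⟨ ℂ-ring.+-congʳ (frobenius-definite (P ⊖ Q) defect i j) ⟩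
      0ᶜ +ᶜ Q i j                 ≈⟨ ℂ-ring.+-identityˡ (Q i j) ⟩
      Q i j                       ∎
      where
      open SetoidReasoning ℂ-ring.setoid
      Q : Matrix N
      Q = columns ψ ⊗ columns ψ †
      defect : tr ((P ⊖ Q) † ⊗ (P ⊖ Q)) ≅ 0ᶜ
      defect = resolution-defect projP {V = columns v} {W = W} P≋VW WV≋𝟙 Ψ†Ψ≋𝟙
        (λ i j → ψ-fixed j i)

    open Compression projP projD ψ-orthonormal resolution ψ-fixed

    normSq-ψ : ∀ i → normSq (ψ i) ≃ 1ʳ
    normSq-ψ i = re-≅ (ℂ-ring.trans (ℂ-ring.sym (inner-self (ψ i)))
      (ℂ-ring.trans (ψ-orthonormal i i) (𝟙-diagonal i)))

    -- The case `k = i` is the admissibility part of maximal concentration; for `i < k` the later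
    -- vector becomes a competitor in the earlier problem, and this orders the eigenvalues.
    ψ-admissible : ∀ {i k} → i Fin.≤ k → Admissible U S F ψ i (ψ k)
    ψ-admissible {i} {k} i≤k = un≃ (≃1⇒√≃1 (normSq-ψ k)) , bandLimited k , λ j j<i →
      to≈ (ℂ-ring.trans (ψ-orthonormal k j)
        (𝟙-off-diagonal k j λ { refl → ℕ.<-irrefl refl (ℕ.<-≤-trans j<i i≤k) }))

  -- Eigenvectors with decreasing eigenvalues are maximally concentrated

  module _ (λs : Fin K → ℝ) (eigen : EigenvectorsOfBDB U S F ψ λs) where
    private
      real : ∀ i → conj (fromℝ (λs i)) ≅ fromℝ (λs i)
      real i = pointwiseᶜ (λ _ → refl) (λ _ → refl)

      eigenᶜ : ∀ i → P ⊗ D S ⊗ P ▹ ψ i ≋ᵛ fromℝ (λs i) ∙ ψ i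
      eigenᶜ i l = from≈ (proj₁ eigen i l)

    concentration-ψ : ∀ i → normSq (D S ▹ ψ i) ≃ λs i
    concentration-ψ i = re-≅ (begin
      fromℝ (normSq (D S ▹ ψ i))     ≈⟨ inner-self (D S ▹ ψ i) ⟨
      ⟪ D S ▹ ψ i , D S ▹ ψ i ⟫      ≈⟨ inner-selfAdjoint projD (ψ i) (D S ▹ ψ i) ⟩
      ⟪ ψ i , D S ▹ (D S ▹ ψ i) ⟫    ≈⟨ inner-congˡ (ψ i) (▹-idempotent projD (ψ i)) ⟩
      ⟪ ψ i , D S ▹ ψ i ⟫            ≈⟨ eigenvectors-orthogonal {μ = λ i → fromℝ (λs i)} real eigenᶜ i i ⟩
      fromℝ (λs i) *ᶜ 𝟙 i i          ≈⟨ ℂ-ring.*-congˡ (𝟙-diagonal i) ⟩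
      fromℝ (λs i) *ᶜ fromℝ 1ʳ       ≈⟨ ℂ-ring.*-identityʳ (fromℝ (λs i)) ⟩
      fromℝ (λs i)                   ∎)
      where open SetoidReasoning ℂ-ring.setoid

    module _ (φ : ℂ^ N) (Pφ≋φ : P ▹ φ ≋ᵛ φ) where
      private
        weight : Fin K → ℝ
        weight k = ∣ ⟪ φ , ψ k ⟫ ∣²

      normSq≃ : normSq φ ≃ sumʳ weight
      normSq≃ = re-≅ (begin
        fromℝ (normSq φ)                                     ≈⟨ inner-self φ ⟨
        ⟪ φ , φ ⟫                                            ≈⟨ parseval φ Pφ≋φ ⟩
        sumᶜ (λ k → ⟪ φ , ψ k ⟫ *ᶜ conj ⟪ φ , ψ k ⟫)
          ≈⟨ ℂΣ.sum-cong-≋ (λ k → z*conj-z ⟪ φ , ψ k ⟫) ⟩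
        sumᶜ (λ k → fromℝ (weight k))                        ≈⟨ fromℝ-sum weight ⟩
        fromℝ (sumʳ weight)                                  ∎)
        where open SetoidReasoning ℂ-ring.setoid

      concentration≃ : normSq (D S ▹ φ) ≃ sumʳ (λ k → λs k *ʳ weight k)
      concentration≃ = re-≅ (begin
        fromℝ (normSq (D S ▹ φ))         ≈⟨ inner-self (D S ▹ φ) ⟨
        ⟪ D S ▹ φ , D S ▹ φ ⟫
          ≈⟨ eigenvalue-concentration {μ = λ i → fromℝ (λs i)} real eigenᶜ Pφ≋φ ⟩
        sumᶜ (λ k → fromℝ (λs k) *ᶜ (⟪ φ , ψ k ⟫ *ᶜ conj ⟪ φ , ψ k ⟫))
          ≈⟨ ℂΣ.sum-cong-≋ (λ k → ℂ-ring.trans (ℂ-ring.*-congˡ (z*conj-z ⟪ φ , ψ k ⟫))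
               (fromℝ-* (λs k) (weight k))) ⟩
        sumᶜ (λ k → fromℝ (λs k *ʳ weight k))  ≈⟨ fromℝ-sum (λ k → λs k *ʳ weight k) ⟩
        fromℝ (sumʳ (λ k → λs k *ʳ weight k))  ∎)
        where open SetoidReasoning ℂ-ring.setoid

      -- The concentration is a mean of the eigenvalues with weights that sum to 1. The weights
      -- before `i` vanish by orthogonality, and the eigenvalues from `i` on are at most `λs i`.
      concentration-bound : ∀ i → normSq φ ≃ 1ʳ → (∀ j → j Fin.< i → ⟪ φ , ψ j ⟫ ≅ 0ᶜ) →
        normSq (D S ▹ φ) ≼ λs i
      concentration-bound i ‖φ‖≃1 orthogonal = begin
        normSq (D S ▹ φ)                   ≈⟨ concentration≃ ⟩
        sumʳ (λ k → λs k *ʳ weight k)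
          ≤⟨ sum-mono-≼ {f = λ k → λs k *ʳ weight k} {g = λ k → λs i *ʳ weight k} termwise ⟩
        sumʳ (λ k → λs i *ʳ weight k)      ≈⟨ ℝΣ.*-distribˡ-sum (λs i) weight ⟨
        λs i *ʳ sumʳ weight                ≈⟨ *ʳ-congˡ (λs i) normSq≃ ⟨
        λs i *ʳ normSq φ                   ≈⟨ *ʳ-congˡ (λs i) ‖φ‖≃1 ⟩
        λs i *ʳ 1ʳ                         ≈⟨ ℝ-ring.*-identityʳ (λs i) ⟩
        λs i                               ∎
        where
        open ≼-Reasoning
        weight-zero : ∀ k → k Fin.< i → weight k ≃ 0ʳ
        weight-zero k k<i = ℝ-ring.trans (∣∣²-cong (orthogonal k k<i)) (pointwise λ _ → refl)
        compare : ∀ k → k Fin.< i ⊎ i Fin.≤ k → λs k *ʳ weight k ≼ λs i *ʳ weight k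
        compare k (inj₁ k<i) = begin
          λs k *ʳ weight k   ≈⟨ *ʳ-congˡ (λs k) (weight-zero k k<i) ⟩
          λs k *ʳ 0ʳ         ≈⟨ ℝ-ring.zeroʳ (λs k) ⟩
          0ʳ                 ≈⟨ ℝ-ring.zeroʳ (λs i) ⟨
          λs i *ʳ 0ʳ         ≈⟨ *ʳ-congˡ (λs i) (weight-zero k k<i) ⟨
          λs i *ʳ weight k   ∎
        compare k (inj₂ i≤k) = begin
          λs k *ʳ weight k   ≈⟨ *ʳ-comm (λs k) (weight k) ⟩
          weight k *ʳ λs k
            ≤⟨ *-monoˡ-≼ (∣z∣²-nonNeg ⟪ φ , ψ k ⟫) (mk≼ (proj₂ eigen i k i≤k)) ⟩
          weight k *ʳ λs i   ≈⟨ *ʳ-comm (weight k) (λs i) ⟩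
          λs i *ʳ weight k   ∎
        termwise : ∀ k → λs k *ʳ weight k ≼ λs i *ʳ weight k
        termwise k = compare k (ℕ.<-≤-connex (Fin.toℕ k) (Fin.toℕ i))

    eigen⇒concentrated : MaximallyConcentrated U S F ψ
    eigen⇒concentrated i = ψ-admissible {i} {i} ℕ.≤-refl , λ φ (‖φ‖≈1 , band , orthogonal) →
      un≼ (√-mono-≼ (nonNeg⇒0≼ (normSq-nonNeg (D S ▹ φ)))
        (≼-trans (concentration-bound φ (λ l → from≈ (band l)) i
                   (√≃1⇒≃1 (nonNeg⇒0≼ (normSq-nonNeg φ)) (mk≃ ‖φ‖≈1))
                   (λ j j<i → from≈ (orthogonal j j<i)))
                 (≼-reflexive (≃-sym (concentration-ψ i)))))

    orthogonal-over-S : ∀ i j → ⟨ ψ i , D S ·ᵛ ψ j ⟩ ≈ fromℝ (λs j *ʳ δ i j)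
    orthogonal-over-S i j = to≈ (ℂ-ring.trans
      (eigenvectors-orthogonal {μ = λ i → fromℝ (λs i)} real eigenᶜ i j)
      (ℂ-ring.trans (ℂ-ring.*-congˡ (ℂ-ring.sym (I≅𝟙 i j))) (fromℝ-* (λs j) (δ i j))))

  -- Maximally concentrated families diagonalise the compression

  module _ (concentrated : MaximallyConcentrated U S F ψ) where
    private
      -- The only candidates: `concentration-ψ` shows that any eigenvalues must equal these squared
      -- norms.
      λs : Fin K → ℝ
      λs i = normSq (D S ▹ ψ i)

    maximal : ∀ i φ → normSq φ ≃ 1ʳ → P ▹ φ ≋ᵛ φ → (∀ j → j Fin.< i → ⟪ φ , ψ j ⟫ ≅ 0ᶜ) →
      normSq (D S ▹ φ) ≼ λs i
    maximal i φ ‖φ‖≃1 Pφ≋φ orthogonal = √-cancel-≼ (nonNeg⇒0≼ (normSq-nonNeg (D S ▹ ψ i)))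
      (mk≼ (proj₂ (concentrated i) φ
        (un≃ (≃1⇒√≃1 ‖φ‖≃1) , (λ l → to≈ (Pφ≋φ l)) , λ j j<i → to≈ (orthogonal j j<i))))

    -- For rational `α`, `β` on the unit circle, `α ψᵢ + β y` again competes in the `i`-th problem:
    -- orthogonality of `y` to the earlier vectors keeps the constraints, and orthogonality to `ψ i`
    -- itself keeps the norm 1. Maximality then bounds the quadratic form of `tangent-bound`.
    stationary : ∀ i y → normSq y ≃ 1ʳ → P ▹ y ≋ᵛ y → (∀ j → j Fin.≤ i → ⟪ y , ψ j ⟫ ≅ 0ᶜ) →
      re ⟪ D S ▹ ψ i , D S ▹ y ⟫ ≼ 0ʳ
    stationary i y ‖y‖≃1 Py≋y orthogonal = tangent-bound (normSq-nonNeg (D S ▹ y)) λ α β α²+β²≡1 →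
      let a = fromℝ (fromℚ α)
          b = fromℝ (fromℚ β)
          φ = a ∙ ψ i ⊞ b ∙ y
          linear : ∀ (A : Matrix N) → A ▹ φ ≋ᵛ a ∙ (A ▹ ψ i) ⊞ b ∙ (A ▹ y)
          linear A l = ℂ-ring.trans (▹-⊞ A (a ∙ ψ i) (b ∙ y) l)
            (ℂ-ring.+-cong (▹-∙ A a (ψ i) l) (▹-∙ A b y l))
          re⟪ψ,y⟫≃0 : re ⟪ ψ i , y ⟫ ≃ 0ʳ
          re⟪ψ,y⟫≃0 = re-≅ (ℂ-ring.trans (ℂ-ring.sym (inner-conj y (ψ i)))
            (ℂ-ring.trans (conj.⟦⟧-cong (orthogonal i ℕ.≤-refl))
              (conj.0#-homo)))
      in begin
        fromℚ (α * α) *ʳ λs i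
          +ʳ fromℚ (α * β) *ʳ (re ⟪ D S ▹ ψ i , D S ▹ y ⟫ +ʳ re ⟪ D S ▹ ψ i , D S ▹ y ⟫)
          +ʳ fromℚ (β * β) *ʳ normSq (D S ▹ y)
            ≈⟨ normSq-combination α β (D S ▹ ψ i) (D S ▹ y) ⟨
        normSq (a ∙ (D S ▹ ψ i) ⊞ b ∙ (D S ▹ y))
            ≈⟨ ℝΣ.sum-cong-≋ (λ l → ∣∣²-cong (linear (D S) l)) ⟨
        normSq (D S ▹ φ)
            ≤⟨ maximal i φ
                 (≃-trans (normSq-combination α β (ψ i) y)
                   (≃-trans (+ʳ-cong (+ʳ-cong (*ʳ-congˡ (fromℚ (α * α)) (normSq-ψ i))
                                              (*ʳ-congˡ (fromℚ (α * β)) (+ʳ-cong re⟪ψ,y⟫≃0 re⟪ψ,y⟫≃0)))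
                                     (*ʳ-congˡ (fromℚ (β * β)) ‖y‖≃1))
                     (pointwise λ _ → trans (solve 3 (λ p q r → p :* con 1ℚ :+ q :* (con 0ℚ :+ con 0ℚ)
                       :+ r :* con 1ℚ := p :+ r) refl (α * α) (α * β) (β * β)) α²+β²≡1)))
                 (λ l → ℂ-ring.trans (linear P l) (ℂ-ring.+-cong
                   (ℂ-ring.*-congˡ (ψ-fixed i l)) (ℂ-ring.*-congˡ (Py≋y l))))
                 (λ j j<i → ℂ-ring.trans (inner-⊞ˡ (a ∙ ψ i) (b ∙ y) (ψ j))
                   (ℂ-ring.trans (ℂ-ring.+-cong
                     (ℂ-ring.trans (inner-∙ˡ a (ψ i) (ψ j)) (ℂ-ring.trans (ℂ-ring.*-congˡ
                       (ℂ-ring.trans (ψ-orthonormal i j)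
                         (𝟙-off-diagonal i j λ { refl → ℕ.<-irrefl refl j<i })))
                       (ℂ-ring.zeroʳ a)))
                     (ℂ-ring.trans (inner-∙ˡ b y (ψ j)) (ℂ-ring.trans (ℂ-ring.*-congˡ
                       (orthogonal j (ℕ.<⇒≤ j<i))) (ℂ-ring.zeroʳ b))))
                     (ℂ-ring.+-identityʳ 0ᶜ))) ⟩
        λs i ∎
      where open ≼-Reasoning

    module _ {i k : Fin K} (i<k : i Fin.< k) where
      private
        m : ℂ
        m = ⟪ D S ▹ ψ i , D S ▹ ψ k ⟫

      -- `stationary` controls a real part only. A phase on `ψ k` preserves all its hypotheses while
      -- multiplying `m` by `conj u`, so other real components of `m` come under control.
      rotated : ∀ u → u *ᶜ conj u ≅ fromℝ 1ʳ → re (conj u *ᶜ m) ≼ 0ʳ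
      rotated u ∣u∣≃1 = ≼-trans
        (≼-reflexive (re-≅ (ℂ-ring.sym (ℂ-ring.trans
          (inner-congˡ (D S ▹ ψ i) (▹-∙ (D S) u (ψ k))) (inner-∙ʳ u (D S ▹ ψ i) (D S ▹ ψ k))))))
        (stationary i (u ∙ ψ k)
          (re-≅ (begin
            fromℝ (normSq (u ∙ ψ k))               ≈⟨ inner-self (u ∙ ψ k) ⟨
            ⟪ u ∙ ψ k , u ∙ ψ k ⟫                  ≈⟨ inner-∙ˡ u (ψ k) (u ∙ ψ k) ⟩
            u *ᶜ ⟪ ψ k , u ∙ ψ k ⟫                 ≈⟨ ℂ-ring.*-congˡ (inner-∙ʳ u (ψ k) (ψ k)) ⟩
            u *ᶜ (conj u *ᶜ ⟪ ψ k , ψ k ⟫)         ≈⟨ ℂ-ring.*-assoc u (conj u) ⟪ ψ k , ψ k ⟫ ⟨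
            u *ᶜ conj u *ᶜ ⟪ ψ k , ψ k ⟫
              ≈⟨ ℂ-ring.*-cong ∣u∣≃1 (ℂ-ring.trans (ψ-orthonormal k k) (𝟙-diagonal k)) ⟩
            fromℝ 1ʳ *ᶜ fromℝ 1ʳ                   ≈⟨ ℂ-ring.*-identityˡ (fromℝ 1ʳ) ⟩
            fromℝ 1ʳ                               ∎))
          (λ l → ℂ-ring.trans (▹-∙ P u (ψ k) l) (ℂ-ring.*-congˡ (ψ-fixed k l)))
          (λ j j≤i → ℂ-ring.trans (inner-∙ˡ u (ψ k) (ψ j)) (ℂ-ring.trans (ℂ-ring.*-congˡ
            (ℂ-ring.trans (ψ-orthonormal k j)
              (𝟙-off-diagonal k j λ { refl → ℕ.<-irrefl refl (ℕ.<-≤-trans i<k j≤i) })))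
            (ℂ-ring.zeroʳ u))))
        where open SetoidReasoning ℂ-ring.setoid

      private
        unit : ℚ → ℚ → ℂ
        unit p q = fromℚ p +i fromℚ q

        rotate : ∀ p q → p * p + q * q ≡ 1ℚ → fromℚ p *ʳ re m +ʳ fromℚ q *ʳ im m ≼ 0ʳ
        rotate p q p²+q²≡1 = ≼-trans (≼-reflexive (pointwise λ n →
          solve 4 (λ p q a b → p :* a :+ q :* b := p :* a :+ :- (:- q :* b)) refl
            p q (seq (re m) n) (seq (im m) n)))
          (rotated (unit p q) (ℂ-ring.trans (z*conj-z (unit p q))
            (fromℝ-cong (pointwise λ _ → p²+q²≡1))))

      off-diagonal : m ≅ 0ᶜ
      off-diagonal =
        vanish (re m)
          (≼-trans (eq λ n → solve 2 (λ a b → a := con 1ℚ :* a :+ con 0ℚ :* b) refl (a n) (b n))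
            (rotate 1ℚ 0ℚ refl))
          (≼-trans (eq λ n → solve 2 (λ a b → :- a := con (- 1ℚ) :* a :+ con 0ℚ :* b) refl (a n) (b n))
            (rotate (- 1ℚ) 0ℚ refl)) ,ᶜ
        vanish (im m)
          (≼-trans (eq λ n → solve 2 (λ a b → b := con 0ℚ :* a :+ con 1ℚ :* b) refl (a n) (b n))
            (rotate 0ℚ 1ℚ refl))
          (≼-trans (eq λ n → solve 2 (λ a b → :- b := con 0ℚ :* a :+ con (- 1ℚ) :* b) refl (a n) (b n))
            (rotate 0ℚ (- 1ℚ) refl))
        where
        a b : ℕ → ℚ
        a = seq (re m)
        b = seq (im m)
        eq : ∀ {x y} → (∀ n → seq x n ≡ seq y n) → x ≼ y
        eq h = ≼-reflexive (pointwise h)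
        vanish : ∀ x → x ≼ 0ʳ → -ʳ x ≼ 0ʳ → x ≃ 0ʳ
        vanish x x≼0 -x≼0 = ≼-antisym x≼0 (begin
          0ʳ           ≈⟨ ℝ-ring.-‿inverseʳ x ⟨
          x +ʳ -ʳ x    ≤⟨ +-mono-≼ (≼-reflexive (≃-refl {x = x})) -x≼0 ⟩
          x +ʳ 0ʳ      ≈⟨ ℝ-ring.+-identityʳ x ⟩
          x            ∎)
          where open ≼-Reasoning

    concentrated⇒eigen : ∃ (EigenvectorsOfBDB U S F ψ)
    concentrated⇒eigen = λs ,
      (λ i l → to≈ (diagonal⇒eigen {μ = λ i → fromℝ (λs i)} diagonal i l)) ,
      -- Monotonicity of the eigenvalues is maximality in the `i`-th problem, tested on the later
      -- vector `ψ j`.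
      λ i j i≤j → un≼ (√-cancel-≼ {λs j} {λs i} (nonNeg⇒0≼ (normSq-nonNeg (D S ▹ ψ i)))
        (mk≼ (proj₂ (concentrated i) (ψ j) (ψ-admissible {i} {j} i≤j))))
      where
      off : ∀ i j → ¬ i ≡ j → ⟪ D S ▹ ψ i , D S ▹ ψ j ⟫ ≅ 0ᶜ →
        ⟪ D S ▹ ψ i , D S ▹ ψ j ⟫ ≅ fromℝ (λs i) *ᶜ 𝟙 i j
      off i j i≢j h = ℂ-ring.trans h (ℂ-ring.sym
        (ℂ-ring.trans (ℂ-ring.*-congˡ (𝟙-off-diagonal i j i≢j)) (ℂ-ring.zeroʳ (fromℝ (λs i)))))
      by-order : ∀ i j → Tri (i Fin.< j) (i ≡ j) (j Fin.< i) →
        ⟪ D S ▹ ψ i , D S ▹ ψ j ⟫ ≅ fromℝ (λs i) *ᶜ 𝟙 i j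
      by-order i j (tri< i<j i≢j _) = off i j i≢j (off-diagonal i<j)
      by-order i j (tri> _ i≢j j<i) = off i j i≢j (ℂ-ring.trans
        (ℂ-ring.sym (inner-conj (D S ▹ ψ j) (D S ▹ ψ i)))
        (ℂ-ring.trans (conj.⟦⟧-cong (off-diagonal j<i))
          (conj.0#-homo)))
      by-order i .i (tri≈ _ refl _) = ℂ-ring.trans (inner-self (D S ▹ ψ i)) (ℂ-ring.sym
        (ℂ-ring.trans (ℂ-ring.*-congˡ (𝟙-diagonal i)) (ℂ-ring.*-identityʳ (fromℝ (λs i)))))
      diagonal : ∀ i j → ⟪ D S ▹ ψ i , D S ▹ ψ j ⟫ ≅ fromℝ (λs i) *ᶜ 𝟙 i j
      diagonal i j = by-order i j (Fin.<-cmp i j)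

mainTheorem3 : ∀ (N : ℕ) (U : Matrix N) → Unitary U →
    ∀ (S F : Subset N) (K : ℕ) → HasRank (B U F) K →
    ∀ (ψ : Fin K → ℂ^ N) → Orthonormal ψ → (∀ i → BandLimited U F (ψ i)) →
    (MaximallyConcentrated U S F ψ ⇔ (∃ λ (λs : Fin K → ℝ) → EigenvectorsOfBDB U S F ψ λs))
    × (∀ (λs : Fin K → ℝ) → EigenvectorsOfBDB U S F ψ λs →
    ∀ i j → ⟨ ψ i , D S ·ᵛ ψ j ⟩ ≈ fromℝ (λs j *ʳ δ i j))
mainTheorem3 N U unitary S F K rank ψ orthonormal bandLimited =
  mk⇔ (concentrated⇒eigen U unitary S F rank ψ orthonormal bandLimited)
      (λ (λs , eigen) → eigen⇒concentrated U unitary S F rank ψ orthonormal bandLimited λs eigen) ,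
  orthogonal-over-S U unitary S F rank ψ orthonormal bandLimited
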